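{- Let $\pi\in S_n$ be Grassmannian. There is a bijection $f:\mathrm{BPD}(\pi)\to\mathrm{PD}^{red}(\pi)$ which is an isomorphism of posets from $\mathrm{droop}(\pi)$ to the dual poset $\mathrm{slide}(\pi)^*$, i.e. $D\le E$ in $\mathrm{droop}(\pi)$ iff $f(E)\le f(D)$ in $\mathrm{slide}(\pi)$.
   Context: $\pi$ is Grassmannian if it has at most one descent (index $i$ with $\pi(i)>\pi(i+1)$). Pipe dreams: tilings of the $n\times n$ grid (rows top to bottom, columns left to right) by cross tiles and elbow tiles (arcs joining north–west and south–east edges), positions $(i,j)$ with $i+j\ge n+1$ elbows; pipes $1..n$ enter at the north border (pipe $j$ above column $j$) and exit at the west border; reduced if no two pipes cross twice, permutation $\pi(i)$ = label of pipe exiting row $i$. $\mathrm{PD}^{red}(\pi)$ = reduced pipe dreams with permutation $\pi$. Bottom pipe dream: the element of $\mathrm{PD}^{red}(\pi)$ with left-justified crosses in each row. Simple slide: a cross at $(r,c)$ with elbows at $(r,c+1),(r-1,c),(r-1,c+1)$ moves to $(r-1,c+1)$. $\mathrm{slide}(\pi)$: pipe dreams reachable from the bottom pipe dream by simple slides, ordered by the reflexive–transitive closure of "$D'$ is obtained from $D$ by a simple slide" ($D<D'$). $\mathrm{slide}(\pi)^*$ is the same set with the order reversed. BPD: tilings of the $n\times n$ grid by cross, horizontal, vertical, r-tile (elbow joining south and east edges), j-tile (elbow joining north and west edges), blank tiles forming $n$ pipes from the south border to the east border; pipes labelled $1..n$ left to right along the south border; reduced if no two pipes cross twice, permutation $\pi(i)$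 = label of pipe exiting row $i$. $\mathrm{BPD}(\pi)$ = reduced BPDs with permutation $\pi$. Rothe BPD: r-tiles at $(i,\pi(i))$, no j-tiles. Simple droop: if $(i,j)$ is an r-tile and $(i+1,j+1)$ blank, replace $(i,j)$ by blank, $(i+1,j+1)$ by a j-tile, $(i+1,j)$: vertical$\to$r-tile or j-tile$\to$horizontal, $(i,j+1)$: horizontal$\to$r-tile or j-tile$\to$vertical. $\mathrm{droop}(\pi)$: BPDs reachable from the Rothe BPD by simple droops, ordered by the reflexive–transitive closure of "$D'$ obtained from $D$ by a simple droop" ($D<D'$). (For such $\pi$ it is known that the underlying sets of $\mathrm{droop}(\pi)$ and $\mathrm{slide}(\pi)$ are $\mathrm{BPD}(\pi)$ and $\mathrm{PD}^{red}(\pi)$.) -}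

module Defs where

open import Data.Nat using (ℕ; zero; suc; _+_; _∸_; _<_; _≤_; _<?_)
open import Data.Bool using (Bool; true; false; if_then_else_)
open import Data.Maybe using (Maybe; just; nothing)
open import Data.Fin using (Fin; toℕ; fromℕ<)
open import Data.Fin.Permutation using (Permutation′; _⟨$⟩ʳ_)
open import Data.Vec using (Vec; []; _∷_; replicate)
open import Data.Product using (Σ; _×_; _,_; proj₁)
open import Data.Sum using (_⊎_)
open import Relation.Nullary using (¬_; yes; no)
open import Relation.Binary.PropositionalEquality using (_≡_; _≢_)
open import Relation.Binary.Construct.Closure.ReflexiveTransitive using (Star)

-- Conventions: everything is 0-indexed.  Rows i = 0..n-1 (top to bottom),
-- columns j = 0..n-1 (left to right), pipe labels 0..n-1.
-- A grid is an n×n array (vector of rows).  Cells are addressed by natural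
-- numbers; 'atℕ d' returns the default tile d outside the grid.

Grid : Set → ℕ → Set
Grid A n = Vec (Vec A n) n

lookupℕ : {A : Set} {m : ℕ} → A → Vec A m → ℕ → A
lookupℕ d []       _       = d
lookupℕ d (x ∷ xs) zero    = x
lookupℕ d (x ∷ xs) (suc i) = lookupℕ d xs i

atℕ : {A : Set} {n : ℕ} → A → Grid A n → ℕ → ℕ → A
atℕ {n = n} d D i j = lookupℕ d (lookupℕ (replicate n d) D i) j

πℕ : {n : ℕ} → Permutation′ n → ℕ → ℕ
πℕ {n} π i with i <? n
... | yes p = toℕ (π ⟨$⟩ʳ fromℕ< p)
... | no _  = 0

Descent : {n : ℕ} → Permutation′ n → ℕ → Set
Descent {n} π i = suc i < n × πℕ π (suc i) < πℕ π i

Grassmannian : {n : ℕ} → Permutation′ n → Set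
Grassmannian π = ∀ i j → Descent π i → Descent π j → i ≡ j

SamePair : {A : Set} → A → A → A → A → Set
SamePair a b a' b' = (a ≡ a' × b ≡ b') ⊎ (a ≡ b' × b ≡ a')

data PDTile : Set where
  cross elbow : PDTile

isCrossP : PDTile → Bool
isCrossP cross = true
isCrossP elbow = false

module PDPipes {n : ℕ} (D : Grid PDTile n) where

  tP : ℕ → ℕ → PDTile
  tP = atℕ elbow D

  -- Pipes enter at the north border (pipe j above column j) and travel
  -- down/left: a cross passes N→S and E→W, an elbow (NW and SE arcs)
  -- sends N→W and E→S.
  mutual
    -- label of the pipe on the north edge of cell (i , j)
    pdN : ℕ → ℕ → Maybe ℕ
    pdN zero    j = just j
    pdN (suc i) j = if isCrossP (tP i j) then pdN i j else pdWest i (n ∸ suc j)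

    -- pdWest i m : label of the pipe on the west edge of the cell in row i,
    -- column n ∸ m  (m = 0 means the east border: no pipe)
    pdWest : ℕ → ℕ → Maybe ℕ
    pdWest i zero    = nothing
    pdWest i (suc m) =
      if isCrossP (tP i (n ∸ suc m)) then pdWest i m else pdN i (n ∸ suc m)

  pdE : ℕ → ℕ → Maybe ℕ
  pdE i j = pdWest i (n ∸ suc j)

  pdExit : ℕ → Maybe ℕ
  pdExit i = pdWest i n

-- positions with i + j ≥ n + 1 (1-indexed) are elbows
IsPD : {n : ℕ} → Grid PDTile n → Set
IsPD {n} D = ∀ i j → i < n → j < n → n ≤ i + j + 1 → atℕ elbow D i j ≡ elbow

PDReduced : {n : ℕ} → Grid PDTile n → Set
PDReduced D = ∀ i j i' j' → tP i j ≡ cross → tP i' j' ≡ cross →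
  SamePair (pdN i j) (pdE i j) (pdN i' j') (pdE i' j') → i ≡ i' × j ≡ j'
  where open PDPipes D

PDPerm : {n : ℕ} → Grid PDTile n → Permutation′ n → Set
PDPerm D π = ∀ i → pdExit (toℕ i) ≡ just (toℕ (π ⟨$⟩ʳ i))
  where open PDPipes D

IsRedPD : {n : ℕ} → Permutation′ n → Grid PDTile n → Set
IsRedPD π D = IsPD D × PDReduced D × PDPerm D π

RedPD : {n : ℕ} → Permutation′ n → Set
RedPD {n} π = Σ (Grid PDTile n) (IsRedPD π)

OutsideBlock : ℕ → ℕ → ℕ → ℕ → Set
OutsideBlock i j k l = (k ≢ i × k ≢ suc i) ⊎ (l ≢ j × l ≢ suc j)

SlideStep : {n : ℕ} → Grid PDTile n → Grid PDTile n → Set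
SlideStep {n} D D' = Σ ℕ λ i → Σ ℕ λ c →
    suc i < n × suc c < n ×
    t (suc i) c ≡ cross × t (suc i) (suc c) ≡ elbow ×
    t i c ≡ elbow × t i (suc c) ≡ elbow ×
    t' (suc i) c ≡ elbow × t' i (suc c) ≡ cross ×
    t' (suc i) (suc c) ≡ elbow × t' i c ≡ elbow ×
    (∀ k l → k < n → l < n → OutsideBlock i c k l → t' k l ≡ t k l)
  where
  t t' : ℕ → ℕ → PDTile
  t  = atℕ elbow D
  t' = atℕ elbow D'

_≤slide_ : {n : ℕ} → Grid PDTile n → Grid PDTile n → Set
_≤slide_ = Star SlideStep

-- rT : elbow joining south and east edges;  jT : elbow joining north and west
data BTile : Set where
  bcross horiz vert rT jT blank : BTile

hasN hasS hasE hasW : BTile → Bool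
hasN bcross = true
hasN horiz  = false
hasN vert   = true
hasN rT     = false
hasN jT     = true
hasN blank  = false
hasS bcross = true
hasS horiz  = false
hasS vert   = true
hasS rT     = true
hasS jT     = false
hasS blank  = false
hasE bcross = true
hasE horiz  = true
hasE vert   = false
hasE rT     = true
hasE jT     = false
hasE blank  = false
hasW bcross = true
hasW horiz  = true
hasW vert   = false
hasW rT     = false
hasW jT     = true
hasW blank  = false

-- the tiles fit together into pipes entering along the whole south border
-- and leaving along the whole east border (north and west borders unused)
IsBPDTiling : {n : ℕ} → Grid BTile n → Set
IsBPDTiling {n} D =
    (∀ i j → suc i < n → j < n → hasS (t i j) ≡ hasN (t (suc i) j)) ×
    (∀ i j → i < n → suc j < n → hasE (t i j) ≡ hasW (t i (suc j))) ×
    (∀ j → j < n → hasN (t 0 j) ≡ false) ×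
    (∀ i → i < n → hasW (t i 0) ≡ false) ×
    (∀ j → j < n → hasS (t (n ∸ 1) j) ≡ true) ×
    (∀ i → i < n → hasE (t i (n ∸ 1)) ≡ true)
  where
  t : ℕ → ℕ → BTile
  t = atℕ blank D

module BPDPipes {n : ℕ} (D : Grid BTile n) where

  tB : ℕ → ℕ → BTile
  tB = atℕ blank D

  -- rows are indexed here by b = distance from the bottom row:
  -- b corresponds to row n ∸ suc b.  Pipe j enters below column j.
  mutual
    -- label of the pipe on the south edge of cell (row of b , j)
    bS : ℕ → ℕ → Maybe ℕ
    bS zero    j = just j
    bS (suc b) j = northOut (tB (n ∸ suc b) j)
      where
      northOut : BTile → Maybe ℕ
      northOut bcross = bS b j
      northOut vert   = bS b j
      northOut jT     = bW b j
      northOut _      = nothing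

    -- label of the pipe on the west edge of cell (row of b , j)
    bW : ℕ → ℕ → Maybe ℕ
    bW b zero    = nothing
    bW b (suc j) = eastOut (tB (n ∸ suc b) j)
      where
      eastOut : BTile → Maybe ℕ
      eastOut bcross = bW b j
      eastOut horiz  = bW b j
      eastOut rT     = bS b j
      eastOut _      = nothing

  -- the two pipes meeting in cell (i , j) (row i from the top)
  southAt westAt : ℕ → ℕ → Maybe ℕ
  southAt i j = bS (n ∸ suc i) j
  westAt  i j = bW (n ∸ suc i) j

  bExit : ℕ → Maybe ℕ
  bExit i = bW (n ∸ suc i) n

BPDReduced : {n : ℕ} → Grid BTile n → Set
BPDReduced D = ∀ i j i' j' → tB i j ≡ bcross → tB i' j' ≡ bcross →
  SamePair (southAt i j) (westAt i j) (southAt i' j') (westAt i' j') →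
  i ≡ i' × j ≡ j'
  where open BPDPipes D

BPDPerm : {n : ℕ} → Grid BTile n → Permutation′ n → Set
BPDPerm D π = ∀ i → bExit (toℕ i) ≡ just (toℕ (π ⟨$⟩ʳ i))
  where open BPDPipes D

IsRedBPD : {n : ℕ} → Permutation′ n → Grid BTile n → Set
IsRedBPD π D = IsBPDTiling D × BPDReduced D × BPDPerm D π

RedBPD : {n : ℕ} → Permutation′ n → Set
RedBPD {n} π = Σ (Grid BTile n) (IsRedBPD π)

DroopStep : {n : ℕ} → Grid BTile n → Grid BTile n → Set
DroopStep {n} D D' = Σ ℕ λ i → Σ ℕ λ j →
    suc i < n × suc j < n ×
    t i j ≡ rT × t (suc i) (suc j) ≡ blank ×
    t' i j ≡ blank × t' (suc i) (suc j) ≡ jT ×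
    ((t (suc i) j ≡ vert × t' (suc i) j ≡ rT) ⊎
     (t (suc i) j ≡ jT × t' (suc i) j ≡ horiz)) ×
    ((t i (suc j) ≡ horiz × t' i (suc j) ≡ rT) ⊎
     (t i (suc j) ≡ jT × t' i (suc j) ≡ vert)) ×
    (∀ k l → k < n → l < n → OutsideBlock i j k l → t' k l ≡ t k l)
  where
  t t' : ℕ → ℕ → BTile
  t  = atℕ blank D
  t' = atℕ blank D'

_≤droop_ : {n : ℕ} → Grid BTile n → Grid BTile n → Set
_≤droop_ = Star DroopStep

module Submission where

-- Let k be the descent of π, so that π increases on the rows before k and on the rows from k on.
-- Call a pipe early if it exits before row k.  Read cell by cell, both kinds of diagram move
-- a sequence of labels by adjacent transpositions, and reducedness forces every crossing to be an
-- inversion of π, hence to involve one early and one late pipe.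
-- For a bumpless pipe dream this means that the rows before k have no crosses, while the rows from
-- k on are those of the Rothe diagram.  For a pipe dream it means that at each cross the early pipe
-- is the horizontal one, and that the rows from k on have no crosses.
-- The bijection turns the first k rows upside down and replaces blank tiles by crosses and all other
-- tiles by elbows.  It matches edges: the north edge of a pipe dream tile carries an early pipe iff
-- the south edge of the bumpless tile is occupied, and the west edge carries an early pipe iff
-- the west edge of the bumpless tile is empty.  A simple droop moves a blank tile from (i+1, j+1) to
-- (i, j), which after the flip is a simple slide read backwards.

open import Defs
open import Data.Nat
open import Data.Nat.Properties
open import Data.Bool using (Bool; true; false; not; if_then_else_; T; _∧_)
open import Data.Unit using (tt)
open import Data.Empty using (⊥; ⊥-elim)
open import Data.Fin using (Fin; toℕ; fromℕ<)
open import Data.Fin.Properties using (toℕ<n; fromℕ<-toℕ; toℕ-fromℕ<)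
open import Data.Fin.Permutation using (Permutation′; _⟨$⟩ʳ_; inverseˡ; flip)
open import Data.Maybe using (Maybe; just; nothing; is-just; fromMaybe)
open import Data.Maybe.Properties using (just-injective)
open import Data.Product using (Σ; ∃; ∃₂; _×_; _,_; proj₁; proj₂)
open import Data.Sum using (_⊎_; inj₁; inj₂; map₂)
open import Data.Vec using (Vec; []; _∷_; replicate; tabulate)
open import Function using (_∘_; case_of_)
open import Function.Bundles using (_⇔_; mk⇔)
open import Relation.Binary.Construct.Closure.ReflexiveTransitive using (ε; _◅_; _◅◅_)
open import Relation.Binary.Definitions using (tri<; tri≈; tri>)
open import Relation.Binary.PropositionalEquality
open import Relation.Nullary using (¬_; yes; no; _×-dec_)
open import Relation.Nullary.Decidable using (dec-true; dec-false)

-- Networks of adjacent transpositions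

-- Reducedness and the permutation are global properties of pipes, while the flip and the two moves
-- are local. The link is `Normal`, a condition on single tiles that is equivalent to lying in
-- `BPD(π)`. The way back from tiles to the permutation is by monotonicity: the pipes leaving
-- through one of the two blocks of rows belong to that block and leave in increasing order, and an
-- increasing self-map of an interval is the identity. No pipe is ever followed along its path. A
-- pipe met beyond its exit shows up as a label occurring twice on one front, which is the diagonal
-- case `Ordered G a a`; the same transport lemmas thus serve both order and distinctness. The grids
-- inside a chain of moves are arbitrary, so information has to be propagated step by step: along
-- droops the position of the blanks, along slides `Normal`.

Ordered : (ℕ → ℕ → Set) → ℕ → ℕ → Set
Ordered G a b = ∃₂ λ x y → x < y × G x a × G y b

module _ (G G' : ℕ → ℕ → Set) (L R : ℕ → Set) (p : ℕ)
  (locate : ∀ {x a} → G x a →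
    (x ≢ p × x ≢ suc p × G' x a) ⊎ (x ≡ p × L a) ⊎ (x ≡ suc p × R a))
  where

  straight-ordered : (∀ {a} → L a → G' p a) → (∀ {a} → R a → G' (suc p) a) →
    ∀ {a b} → Ordered G a b → Ordered G' a b
  straight-ordered l r {a} {b} (x , y , x<y , gx , gy) = x , y , x<y , keep gx , keep gy
    where
    keep : ∀ {x a} → G x a → G' x a
    keep g with locate g
    ... | inj₁ (_ , _ , g') = g'
    ... | inj₂ (inj₁ (refl , la)) = l la
    ... | inj₂ (inj₂ (refl , ra)) = r ra

  -- No position lies between `p` and `suc p`, and all others are kept, so a pair can be reversed
  -- only if it occupies exactly these two.
  swap-ordered : (∀ {a} → L a → G' (suc p) a) → (∀ {a} → R a → G' p a) →
    ∀ {a b} → Ordered G a b → Ordered G' a b ⊎ (L a × R b)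
  swap-ordered l r {a} {b} (x , y , x<y , gx , gy) with locate gx | locate gy
  ... | inj₁ (_ , _ , gx') | inj₁ (_ , _ , gy') = inj₁ (x , y , x<y , gx' , gy')
  ... | inj₁ (_ , _ , gx') | inj₂ (inj₁ (refl , la)) = inj₁ (x , suc p , m<n⇒m<1+n x<y , gx' , l la)
  ... | inj₁ (x≢p , _ , gx') | inj₂ (inj₂ (refl , rb)) =
    inj₁ (x , p , ≤∧≢⇒< (≤-pred x<y) x≢p , gx' , r rb)
  ... | inj₂ (inj₁ (refl , la)) | inj₁ (_ , y≢ , gy') =
    inj₁ (suc p , y , ≤∧≢⇒< x<y (λ e → y≢ (sym e)) , l la , gy')
  ... | inj₂ (inj₁ (refl , la)) | inj₂ (inj₁ (refl , _)) = ⊥-elim (<-irrefl refl x<y)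
  ... | inj₂ (inj₁ (refl , la)) | inj₂ (inj₂ (refl , rb)) = inj₂ (la , rb)
  ... | inj₂ (inj₂ (refl , ra)) | inj₁ (_ , _ , gy') = inj₁ (p , y , <-trans (n<1+n p) x<y , r ra , gy')
  ... | inj₂ (inj₂ (refl , ra)) | inj₂ (inj₁ (refl , _)) = ⊥-elim (<-asym x<y (n<1+n p))
  ... | inj₂ (inj₂ (refl , ra)) | inj₂ (inj₂ (refl , _)) = ⊥-elim (<-irrefl refl x<y)

data Cell (N W : ℕ → ℕ → Maybe ℕ) (X : Set) (i j : ℕ) : Set where
  straight : W i j ≡ N i j → N (suc i) j ≡ W i (suc j) → Cell N W X i j
  swapped  : W i j ≡ W i (suc j) → N (suc i) j ≡ N i j →
    (∀ {a b} → N i j ≡ just a → W i (suc j) ≡ just b → X) → Cell N W X i j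

-- Pipe dreams are read through this network downwards, bumpless pipe dreams upwards.  Vertical and
-- horizontal tiles count as swaps with an unlabelled edge, for which X is not demanded.
module Network (n : ℕ) (N W : ℕ → ℕ → Maybe ℕ) (X : ℕ → ℕ → Set)
  (cell : ∀ {i j} → i < n → j < n → Cell N W (X i j) i j)
  where

  -- The front after processing row i from the right down to column j: label a is at position x.
  -- Positions run along the west border above row i, the staircase through cell (i , j), and the
  -- east border below row i.
  data At (i j x a : ℕ) : Set where
    west  : x < i → W x 0 ≡ just a → At i j x a
    north : ∀ t → t < j → x ≡ i + t → N i t ≡ just a → At i j x a
    here  : i < n → x ≡ i + j → W i j ≡ just a → At i j x a
    south : ∀ t → j ≤ t → t < n → x ≡ suc (i + t) → N (suc i) t ≡ just a → At i j x a
    east  : ∀ r → i < r → r < n → x ≡ r + n → W r n ≡ just a → At i j x a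

  Ord : ℕ → ℕ → ℕ → ℕ → Set
  Ord i j = Ordered (At i j)

  Cross : ℕ → ℕ → ℕ → ℕ → Set
  Cross i j a b = X i j × (N i j ≡ just a × W i (suc j) ≡ just b) ×
                          (W i j ≡ just b × N (suc i) j ≡ just a)

  module _ {i j : ℕ} (i<n : i < n) (j<n : j < n) where

    east-far : ∀ {r x} → i < r → x ≡ r + n → suc (i + j) < x
    east-far i<r refl = +-mono-≤-< i<r j<n

    locate-before : ∀ {x a} → At i (suc j) x a →
      (x ≢ i + j × x ≢ suc (i + j) × At i j x a) ⊎
      (x ≡ i + j × N i j ≡ just a) ⊎ (x ≡ suc (i + j) × W i (suc j) ≡ just a)
    locate-before (west x<i e) =
      inj₁ (<⇒≢ x<p , <⇒≢ (m<n⇒m<1+n x<p) , west x<i e)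
      where x<p = <-≤-trans x<i (m≤m+n i j)
    locate-before (north t t<sj refl e) with m≤n⇒m<n∨m≡n (≤-pred t<sj)
    ... | inj₂ refl = inj₂ (inj₁ (refl , e))
    ... | inj₁ t<j = inj₁ (<⇒≢ x<p , <⇒≢ (m<n⇒m<1+n x<p) , north t t<j refl e)
      where x<p = +-monoʳ-< i t<j
    locate-before (here _ refl e) = inj₂ (inj₂ (+-suc i j , e))
    locate-before (south t j<t t<n refl e) =
      inj₁ (>⇒≢ (m<n⇒m<1+n p<) , (λ q → <⇒≢ p< (sym (suc-injective q))) , south t (<⇒≤ j<t) t<n refl e)
      where p< = +-monoʳ-< i j<t
    locate-before (east r i<r r<n e' e) =
      inj₁ (>⇒≢ (<-trans (n<1+n _) far) , >⇒≢ far , east r i<r r<n e' e)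
      where far = east-far i<r e'

    locate-after : ∀ {x a} → At i j x a →
      (x ≢ i + j × x ≢ suc (i + j) × At i (suc j) x a) ⊎
      (x ≡ i + j × W i j ≡ just a) ⊎ (x ≡ suc (i + j) × N (suc i) j ≡ just a)
    locate-after (west x<i e) =
      inj₁ (<⇒≢ x<p , <⇒≢ (m<n⇒m<1+n x<p) , west x<i e)
      where x<p = <-≤-trans x<i (m≤m+n i j)
    locate-after (north t t<j refl e) =
      inj₁ (<⇒≢ x<p , <⇒≢ (m<n⇒m<1+n x<p) , north t (m<n⇒m<1+n t<j) refl e)
      where x<p = +-monoʳ-< i t<j
    locate-after (here _ refl e) = inj₂ (inj₁ (refl , e))
    locate-after (south t j≤t t<n refl e) with m≤n⇒m<n∨m≡n j≤t
    ... | inj₂ refl = inj₂ (inj₂ (refl , e))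
    ... | inj₁ j<t =
      inj₁ (>⇒≢ (m<n⇒m<1+n p<) , (λ q → <⇒≢ p< (sym (suc-injective q))) , south t j<t t<n refl e)
      where p< = +-monoʳ-< i j<t
    locate-after (east r i<r r<n e' e) =
      inj₁ (>⇒≢ (<-trans (n<1+n _) far) , >⇒≢ far , east r i<r r<n e' e)
      where far = east-far i<r e'

    downCell : ∀ {a b} → Ord i (suc j) a b → Ord i j a b ⊎ Cross i j a b
    downCell o with cell i<n j<n
    ... | straight e e' = inj₁ (straight-ordered (At i (suc j)) (At i j)
            (λ a → N i j ≡ just a) (λ a → W i (suc j) ≡ just a) (i + j) locate-before
            (λ l → here i<n refl (trans e l))
            (λ r → south j ≤-refl j<n refl (trans e' r)) o)
    ... | swapped e e' c = map₂ (λ (l , r) → c l r , (l , r) , trans e r , trans e' l)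
            (swap-ordered (At i (suc j)) (At i j)
            (λ a → N i j ≡ just a) (λ a → W i (suc j) ≡ just a) (i + j) locate-before
            (λ l → south j ≤-refl j<n refl (trans e' l))
            (λ r → here i<n refl (trans e r)) o)

    upCell : ∀ {a b} → Ord i j a b → Ord i (suc j) a b ⊎ Cross i j b a
    upCell o with cell i<n j<n
    ... | straight e e' = inj₁ (straight-ordered (At i j) (At i (suc j))
            (λ a → W i j ≡ just a) (λ a → N (suc i) j ≡ just a) (i + j) locate-after
            (λ l → north j ≤-refl refl (trans (sym e) l))
            (λ r → here i<n (sym (+-suc i j)) (trans (sym e') r)) o)
    ... | swapped e e' c = map₂
            (λ (l , r) → let l' = trans (sym e) l ; r' = trans (sym e') r in c r' l' , (r' , l') , l , r)
            (swap-ordered (At i j) (At i (suc j))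
            (λ a → W i j ≡ just a) (λ a → N (suc i) j ≡ just a) (i + j) locate-after
            (λ l → here i<n (sym (+-suc i j)) (trans (sym e) l))
            (λ r → north j ≤-refl refl (trans (sym e') r)) o)

    cross-after : ∀ {a b} → Cross i j a b → Ord i j b a
    cross-after (_ , _ , w , s) =
      i + j , suc (i + j) , ≤-refl , here i<n refl w , south j ≤-refl j<n refl s

    cross-before : ∀ {a b} → Cross i j a b → Ord i (suc j) a b
    cross-before (_ , (l , r) , _) =
      i + j , i + suc j , +-monoʳ-< i (n<1+n j) , north j ≤-refl refl l , here i<n refl r

  nextRow : ∀ {i a b} → Ord i 0 a b → Ord (suc i) n a b
  nextRow {i} (x , y , x<y , p , q) = x , y , x<y , next p , next q
    where
    next : ∀ {x a} → At i 0 x a → At (suc i) n x a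
    next (west x<i e) = west (m<n⇒m<1+n x<i) e
    next (here _ refl e) rewrite +-identityʳ i = west ≤-refl e
    next (south t _ t<n x≡ e) = north t t<n x≡ e
    next (east r i<r r<n x≡ e) with m≤n⇒m<n∨m≡n i<r
    ... | inj₁ lt = east r lt r<n x≡ e
    ... | inj₂ refl = here r<n x≡ e

  prevRow : ∀ {i a b} → i < n → Ord (suc i) n a b → Ord i 0 a b
  prevRow {i} i<n (x , y , x<y , p , q) = x , y , x<y , prev p , prev q
    where
    prev : ∀ {x a} → At (suc i) n x a → At i 0 x a
    prev (west x<si e) with m≤n⇒m<n∨m≡n (≤-pred x<si)
    ... | inj₁ lt = west lt e
    ... | inj₂ refl = here i<n (sym (+-identityʳ i)) e
    prev (north t t<n x≡ e) = south t z≤n t<n x≡ e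
    prev (here si<n x≡ e) = east (suc i) ≤-refl si<n x≡ e
    prev (south t n≤t t<n _ _) = ⊥-elim (<-irrefl refl (≤-<-trans n≤t t<n))
    prev (east r i<r r<n x≡ e) = east r (<-trans (n<1+n _) i<r) r<n x≡ e

  module _ (P : ℕ → ℕ → Set) where

    rowDown : ∀ {i j j'} → j' ≤ j → (∀ {l} → j' ≤ l → l < j → P i (suc l) → P i l) →
      P i j → P i j'
    rowDown {i} {j} {j'} j'≤j step p with m≤n⇒m<n∨m≡n j'≤j
    ... | inj₂ refl = p
    rowDown {i} {suc j} {j'} _ step p | inj₁ (s≤s j'≤j) =
      rowDown j'≤j (λ a b → step a (m<n⇒m<1+n b)) (step j'≤j ≤-refl p)

    rowUp : ∀ {i j j'} → j ≤ j' → (∀ {l} → j ≤ l → l < j' → P i l → P i (suc l)) →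
      P i j → P i j'
    rowUp {i} {j} {j'} j≤j' step p with m≤n⇒m<n∨m≡n j≤j'
    ... | inj₂ refl = p
    rowUp {i} {j} {suc j'} _ step p | inj₁ (s≤s j≤j') =
      step j≤j' ≤-refl (rowUp j≤j' (λ a b → step a (m<n⇒m<1+n b)) p)

    rowsDown : ∀ {i i'} → i < i' → (∀ {r} → P r 0 → P (suc r) n) →
      (∀ {r l} → i < r → r < i' → l < n → P r (suc l) → P r l) →
      P i 0 → P i' n
    rowsDown {i} {suc i'} (s≤s i≤i') next step p with m≤n⇒m<n∨m≡n i≤i'
    ... | inj₂ refl = next p
    ... | inj₁ i<i' = next (rowDown z≤n (λ _ → step i<i' ≤-refl)
            (rowsDown i<i' next (λ a b → step a (m<n⇒m<1+n b)) p))

    rowsUp : ∀ {i} → (∀ {r} → r < i → P (suc r) n → P r 0) →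
      (∀ {r l} → r < i → l < n → P r l → P r (suc l)) → P i n → P 0 n
    rowsUp {zero} prev step p = p
    rowsUp {suc i} prev step p = rowsUp (λ a → prev (m<n⇒m<1+n a)) (λ a → step (m<n⇒m<1+n a))
      (rowUp z≤n (λ _ → step ≤-refl) (prev ≤-refl p))

  -- Only a crossing of the opposite orientation can undo the order on the way up. The implication
  -- `j < n → i < n` admits `i ≡ n` together with `j ≡ n`, the front below the last row.
  ascend : ∀ {i j a b} → i ≤ n → (j < n → i < n) → j ≤ n →
    (∀ {r l} → r < n → l < n → r < i ⊎ (r ≡ i × j ≤ l) → ¬ Cross r l b a) →
    Ord i j a b → Ord 0 n a b
  ascend {i} {j} {a} {b} i≤n valid j≤n free o =
    rowsUp P (λ r<i → prevRow (<-≤-trans r<i i≤n)) (λ r<i l<n → step (<-≤-trans r<i i≤n) l<n (inj₁ r<i))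
      (rowUp P j≤n (λ j≤l l<n → step (valid (≤-<-trans j≤l l<n)) l<n (inj₂ (refl , j≤l))) o)
    where
    P : ℕ → ℕ → Set
    P r l = Ord r l a b
    step : ∀ {r l} → r < n → l < n → r < i ⊎ (r ≡ i × j ≤ l) → P r l → P r (suc l)
    step r<n l<n c p with upCell r<n l<n p
    ... | inj₁ p' = p'
    ... | inj₂ x = ⊥-elim (free r<n l<n c x)

  descend : ∀ {i j a b} → i < n → j ≤ n →
    (∀ {r l} → r < n → l < n → i < r ⊎ (r ≡ i × l < j) → ¬ Cross r l a b) →
    Ord i j a b → Ord n n a b
  descend {i} {j} {a} {b} i<n j≤n free o =
    rowsDown P i<n nextRow (λ i<r r<n l<n → step r<n l<n (inj₁ i<r))
      (rowDown P z≤n (λ _ l<j → step i<n (<-≤-trans l<j j≤n) (inj₂ (refl , l<j))) o)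
    where
    P : ℕ → ℕ → Set
    P r l = Ord r l a b
    step : ∀ {r l} → r < n → l < n → i < r ⊎ (r ≡ i × l < j) → P r (suc l) → P r l
    step r<n l<n c p with downCell r<n l<n p
    ... | inj₁ p' = p'
    ... | inj₂ x = ⊥-elim (free r<n l<n c x)

  position-unique : ∀ {i j a x y} → ¬ Ord i j a a → At i j x a → At i j y a → x ≡ y
  position-unique {x = x} {y} irr p q with <-cmp x y
  ... | tri< x<y _ _ = ⊥-elim (irr (x , y , x<y , p , q))
  ... | tri≈ _ e _ = e
  ... | tri> _ _ y<x = ⊥-elim (irr (y , x , y<x , q , p))

  module _ (unique : ∀ {i j i' j' a b a' b'} → Cross i j a b → Cross i' j' a' b' →
                     SamePair a b a' b' → i ≡ i' × j ≡ j') where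

    -- The pair crosses nowhere else, so its order on the upper side of the cell survives to the top
    -- front and its reversed order on the lower side survives to the bottom front.
    crossing-inverts : ∀ {i j a b} → i < n → j < n → Cross i j a b → Ord 0 n a b × Ord n n b a
    crossing-inverts {i} {j} {a} {b} i<n j<n c =
      ascend (<⇒≤ i<n) (λ _ → i<n) j<n above (cross-before i<n j<n c) ,
      descend i<n (<⇒≤ j<n) below (cross-after i<n j<n c)
      where
      above : ∀ {r l} → r < n → l < n → r < i ⊎ (r ≡ i × suc j ≤ l) → ¬ Cross r l b a
      above _ _ w x with unique c x (inj₂ (refl , refl))
      above _ _ (inj₁ r<i) x | refl , refl = <-irrefl refl r<i
      above _ _ (inj₂ (_ , j<l)) x | refl , refl = <-irrefl refl j<l
      below : ∀ {r l} → r < n → l < n → i < r ⊎ (r ≡ i × l < j) → ¬ Cross r l b a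
      below _ _ w x with unique c x (inj₂ (refl , refl))
      below _ _ (inj₁ i<r) x | refl , refl = <-irrefl refl i<r
      below _ _ (inj₂ (_ , l<j)) x | refl , refl = <-irrefl refl l<j

  module _ (oriented : ∀ {i j i' j' a b} → Cross i j a b → ¬ Cross i' j' b a)
           (distinct : ∀ {a} → ¬ Ord 0 n a a) where

    -- A label crossing itself would be a crossing of both orientations at once, so a repeated label
    -- would stay repeated up to the top front.
    injective : ∀ {i j a} → i < n → j ≤ n → ¬ Ord i j a a
    injective i<n j≤n o = distinct (ascend (<⇒≤ i<n) (λ _ → i<n) j≤n (λ _ _ _ c → oriented c c) o)

    asymmetric : ∀ {i j a b} → i < n → j ≤ n → Ord i j a b → ¬ Ord i j b a
    asymmetric i<n j≤n (x , y , x<y , p , q) (y' , x' , y'<x' , q' , p')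
      with refl ← position-unique (injective i<n j≤n) p p' | refl ← position-unique (injective i<n j≤n) q q' =
      <-asym x<y y'<x'

    -- Below the first crossing `b` stands left of `a`. Only a crossing of the opposite orientation
    -- could restore the old order, which a second crossing of `a` and `b` would require.
    crossed-once : ∀ {i j i' j' a b} → i < n → j < n → i' < n → j' < n →
      i < i' ⊎ (i ≡ i' × j' < j) → Cross i j a b → ¬ Cross i' j' a b
    crossed-once {i} {j} {i'} {j'} {a} {b} i<n j<n i'<n j'<n w c c' = go w after
      where
      P : ℕ → ℕ → Set
      P r l = Ord r l b a
      after : P i j
      after = cross-after i<n j<n c
      step : ∀ {r l} → r < n → l < n → P r (suc l) → P r l
      step r<n l<n p with downCell r<n l<n p
      ... | inj₁ p' = p'
      ... | inj₂ x = ⊥-elim (oriented c x)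
      end : ¬ P i' (suc j')
      end p = asymmetric i'<n j'<n p (cross-before i'<n j'<n c')
      go : i < i' ⊎ (i ≡ i' × j' < j) → ¬ P i j
      go (inj₂ (refl , j'<j)) p =
        end (rowDown P j'<j (λ _ l<j → step i<n (<-trans l<j j<n)) p)
      go (inj₁ i<i') p =
        end (rowDown P j'<n (λ _ → step i'<n)
          (rowsDown P i<i' nextRow (λ _ r<i' → step (<-trans r<i' i'<n))
            (rowDown P z≤n (λ _ l<j → step i<n (<-trans l<j j<n)) p)))

    oriented⇒unique : ∀ {i j i' j' a b a' b'} → i < n → j < n → i' < n → j' < n →
      Cross i j a b → Cross i' j' a' b' → SamePair a b a' b' → i ≡ i' × j ≡ j'
    oriented⇒unique i<n j<n i'<n j'<n c c' (inj₂ (refl , refl)) = ⊥-elim (oriented c c')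
    oriented⇒unique {i} {j} {i'} {j'} i<n j<n i'<n j'<n c c' (inj₁ (refl , refl))
      with <-cmp i i' | <-cmp j j'
    ... | tri< i<i' _ _ | _ = ⊥-elim (crossed-once i<n j<n i'<n j'<n (inj₁ i<i') c c')
    ... | tri> _ _ i'<i | _ = ⊥-elim (crossed-once i'<n j'<n i<n j<n (inj₁ i'<i) c' c)
    ... | tri≈ _ refl _ | tri< j<j' _ _ = ⊥-elim (crossed-once i'<n j'<n i<n j<n (inj₂ (refl , j<j')) c' c)
    ... | tri≈ _ refl _ | tri> _ _ j'<j = ⊥-elim (crossed-once i<n j<n i'<n j'<n (inj₂ (refl , j'<j)) c c')
    ... | tri≈ _ i≡ _ | tri≈ _ j≡ _ = i≡ , j≡

-- Grassmannian permutations

lt-true : ∀ {m n} → m < n → (m <ᵇ n) ≡ true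
lt-true {m} {n} = dec-true (m <? n)

lt-false : ∀ {m n} → ¬ m < n → (m <ᵇ n) ≡ false
lt-false {m} {n} = dec-false (m <? n)

true-lt : ∀ {m n} → (m <ᵇ n) ≡ true → m < n
true-lt {m} {n} e = <ᵇ⇒< m n (subst T (sym e) tt)

false-lt : ∀ {m n} → (m <ᵇ n) ≡ false → ¬ m < n
false-lt e m<n with trans (sym e) (lt-true m<n)
... | ()

increasing-from-steps : ∀ {f : ℕ → ℕ} {lo hi} →
  (∀ {i} → lo ≤ i → suc i < hi → f i < f (suc i)) →
  ∀ {i i'} → lo ≤ i → i < i' → i' < hi → f i < f i'
increasing-from-steps {f} step {i} {suc i'} lo≤i (s≤s i≤i') i'<hi with m≤n⇒m<n∨m≡n i≤i'
... | inj₂ refl = step lo≤i i'<hi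
... | inj₁ i<i' = <-trans (increasing-from-steps {f} step lo≤i i<i' (<-trans (n<1+n i') i'<hi))
                          (step (≤-trans lo≤i i≤i') i'<hi)

-- Strict increase gives `i ≤ f i` by induction from the lower end and `f i ≤ i` from the upper end.
-- It is applied to the map taking a row `i` to `q` of the label that exits there, and identifies
-- that label as `p i`.
increasing-self-map : ∀ {f : ℕ → ℕ} {lo hi} →
  (∀ {i} → lo ≤ i → i < hi → lo ≤ f i × f i < hi) →
  (∀ {i i'} → lo ≤ i → i < i' → i' < hi → f i < f i') →
  ∀ {i} → lo ≤ i → i < hi → f i ≡ i
increasing-self-map {f} {lo} {hi} bounds inc lo≤i i<hi =
  ≤-antisym (upper _ (m+[n∸m]≡n i<hi) lo≤i) (lower lo≤i i<hi)
  where
  lower : ∀ {i} → lo ≤ i → i < hi → i ≤ f i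
  lower {i} lo≤i i<hi with m≤n⇒m<n∨m≡n lo≤i
  ... | inj₂ refl = proj₁ (bounds lo≤i i<hi)
  lower {suc i} _ i<hi | inj₁ (s≤s lo≤i) =
    ≤-<-trans (lower lo≤i i<hi') (inc lo≤i (n<1+n i) i<hi)
    where i<hi' = <-trans (n<1+n i) i<hi
  upper : ∀ d {i} → suc i + d ≡ hi → lo ≤ i → f i ≤ i
  upper zero {i} e lo≤i = ≤-pred (subst (f i <_) (trans (sym e) (+-identityʳ _))
    (proj₂ (bounds lo≤i (subst (i <_) (trans (sym (+-identityʳ _)) e) ≤-refl))))
  upper (suc d) {i} e lo≤i = ≤-pred (<-≤-trans
    (inc lo≤i (n<1+n i) (subst (suc i <_) e' (m≤m+n (suc (suc i)) d)))
    (upper d {suc i} e' (m≤n⇒m≤1+n lo≤i)))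
    where e' = trans (sym (+-suc (suc i) d)) e

-- `q` is the inverse of `p`, so `q l` is the exit row of pipe `l`. The one-line word of `q` is a
-- shuffle of the increasing words on the rows before `k` and on the rows from `k` on.
record Shuffle (n k : ℕ) (p q : ℕ → ℕ) : Set where
  field
    k≤n  : k ≤ n
    p<n  : ∀ {i} → i < n → p i < n
    q<n  : ∀ {j} → j < n → q j < n
    pq   : ∀ {j} → j < n → p (q j) ≡ j
    qp   : ∀ {i} → i < n → q (p i) ≡ i
    incA : ∀ {i i'} → i < i' → i' < k → p i < p i'
    incB : ∀ {i i'} → k ≤ i → i < i' → i' < n → p i < p i'

  -- Within each block `p` increases, so two early pipes, or two late ones, exit in the order of
  -- their labels.
  inversion : ∀ {a b} → a < n → b < n → a < b → q b < q a → q b < k × k ≤ q a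
  inversion {a} {b} a<n b<n a<b qb<qa with k ≤? q a
  ... | no k≰qa = ⊥-elim (<-asym a<b
        (subst₂ _<_ (pq b<n) (pq a<n) (incA qb<qa (≰⇒> k≰qa))))
  ... | yes k≤qa with k ≤? q b
  ... | no k≰qb = ≰⇒> k≰qb , k≤qa
  ... | yes k≤qb = ⊥-elim (<-asym a<b
        (subst₂ _<_ (pq b<n) (pq a<n) (incB k≤qb qb<qa (q<n a<n))))

  q-injective : ∀ {a b} → a < n → b < n → q a ≡ q b → a ≡ b
  q-injective a<n b<n e = trans (sym (pq a<n)) (trans (cong p e) (pq b<n))

  -- An inversion would need `a` late and `b` early; each alternative of the last hypothesis
  -- excludes this.
  q-increasing : ∀ {a b} → a < n → b < n → a < b → q a < k ⊎ k ≤ q b → q a < q b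
  q-increasing {a} {b} a<n b<n a<b c with <-cmp (q a) (q b)
  ... | tri< lt' _ _ = lt'
  ... | tri≈ _ e _ = ⊥-elim (<⇒≢ a<b (q-injective a<n b<n e))
  ... | tri> _ _ gt with inversion a<n b<n a<b gt | c
  ... | _ , k≤qa | inj₁ qa<k = ⊥-elim (<⇒≱ qa<k k≤qa)
  ... | qb<k , _ | inj₂ k≤qb = ⊥-elim (<⇒≱ qb<k k≤qb)

  right-of-bound : ∀ {i j} → k ≤ i → i < n → j < n → i < q j → p i < j
  right-of-bound k≤i i<n j<n i<qj = subst (p _ <_) (pq j<n) (incB k≤i i<qj (q<n j<n))

πℕ-toℕ : ∀ {n} (π : Permutation′ n) {i} (i<n : i < n) → πℕ π i ≡ toℕ (π ⟨$⟩ʳ fromℕ< i<n)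
πℕ-toℕ {n} π {i} i<n with i <? n
... | yes i<n' = cong (λ h → toℕ (π ⟨$⟩ʳ fromℕ< h)) (<-irrelevant i<n' i<n)
... | no i≮n = ⊥-elim (i≮n i<n)

πℕ-Fin : ∀ {n} (π : Permutation′ n) (i : Fin n) → πℕ π (toℕ i) ≡ toℕ (π ⟨$⟩ʳ i)
πℕ-Fin π i = trans (πℕ-toℕ π (toℕ<n i)) (cong (λ h → toℕ (π ⟨$⟩ʳ h)) (fromℕ<-toℕ i (toℕ<n i)))

πℕ-< : ∀ {n} (π : Permutation′ n) {i} → i < n → πℕ π i < n
πℕ-< π i<n = subst (_< _) (sym (πℕ-toℕ π i<n)) (toℕ<n _)

πℕ-inverse : ∀ {n} (π : Permutation′ n) {i} → i < n → πℕ (flip π) (πℕ π i) ≡ i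
πℕ-inverse π i<n = trans (cong (πℕ (flip π)) (πℕ-toℕ π i<n))
  (trans (πℕ-Fin (flip π) _) (trans (cong toℕ (inverseˡ π)) (toℕ-fromℕ< i<n)))

πℕ-inverse′ : ∀ {n} (π : Permutation′ n) {j} → j < n → πℕ π (πℕ (flip π) j) ≡ j
πℕ-inverse′ π = πℕ-inverse (flip π)

no-descent : ∀ {n} (π : Permutation′ n) {i} → suc i < n → ¬ Descent π i → πℕ π i < πℕ π (suc i)
no-descent π {i} si<n ¬d with <-cmp (πℕ π i) (πℕ π (suc i))
... | tri< l _ _ = l
... | tri> _ _ g = ⊥-elim (¬d (si<n , g))
... | tri≈ _ e _ = ⊥-elim (<⇒≢ (n<1+n i) (trans (sym (πℕ-inverse π (<-trans (n<1+n i) si<n)))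
                     (trans (cong (πℕ (flip π)) e) (πℕ-inverse π si<n))))

shuffle-at : ∀ {n} (π : Permutation′ n) k → k ≤ n →
  (∀ {i} → suc i < n → suc i ≢ k → ¬ Descent π i) → Shuffle n k (πℕ π) (πℕ (flip π))
shuffle-at π k k≤n free = record
  { k≤n = k≤n
  ; p<n = πℕ-< π
  ; q<n = πℕ-< (flip π)
  ; pq = πℕ-inverse′ π
  ; qp = πℕ-inverse π
  ; incA = increasing-from-steps {πℕ π} {0} (λ _ lt' →
      no-descent π (<-≤-trans lt' k≤n) (free (<-≤-trans lt' k≤n) (<⇒≢ lt'))) z≤n
  ; incB = increasing-from-steps {πℕ π} (λ k≤i lt' →
      no-descent π lt' (free lt' (>⇒≢ (s≤s k≤i))))
  }

grassmannian⇒shuffle : ∀ {n} (π : Permutation′ n) → Grassmannian π →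
  ∃ λ k → Shuffle n k (πℕ π) (πℕ (flip π))
grassmannian⇒shuffle {n} π g with anyUpTo? (λ i → (suc i <? n) ×-dec (πℕ π (suc i) <? πℕ π i)) n
... | yes (i , _ , d) = suc i , shuffle-at π (suc i) (<⇒≤ (proj₁ d))
        (λ {i'} _ ne d' → ne (cong suc (g i' i d' d)))
-- Without a descent all pipes count as early and the block of late rows is empty.
... | no none = n , shuffle-at π n ≤-refl
        (λ {i} si<n _ d → none (i , <-trans (n<1+n i) si<n , d))

-- Grids and bumpless pipe labels

private variable
  A : Set
  m n : ℕ

lookupℕ-beyond : ∀ (d : A) (v : Vec A m) {i} → m ≤ i → lookupℕ d v i ≡ d
lookupℕ-beyond d [] _ = refl
lookupℕ-beyond d (x ∷ v) (s≤s m≤i) = lookupℕ-beyond d v m≤i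

lookupℕ-ext : ∀ (d : A) (v w : Vec A m) → (∀ {i} → i < m → lookupℕ d v i ≡ lookupℕ d w i) → v ≡ w
lookupℕ-ext d [] [] _ = refl
lookupℕ-ext d (x ∷ v) (y ∷ w) e = cong₂ _∷_ (e z<s) (lookupℕ-ext d v w (e ∘ s<s))

lookupℕ-tabulate : ∀ (d : A) (f : ℕ → A) {i} → i < m → lookupℕ d (tabulate {n = m} (f ∘ toℕ)) i ≡ f i
lookupℕ-tabulate {m = suc m} d f {zero} _ = refl
lookupℕ-tabulate {m = suc m} d f {suc i} (s≤s i<m) = lookupℕ-tabulate d (f ∘ suc) i<m

lookupℕ-replicate : ∀ (d : A) m i → lookupℕ d (replicate m d) i ≡ d
lookupℕ-replicate d zero i = refl
lookupℕ-replicate d (suc m) zero = refl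
lookupℕ-replicate d (suc m) (suc i) = lookupℕ-replicate d m i

gridFrom : (ℕ → ℕ → A) → Grid A n
gridFrom f = tabulate (λ i → tabulate (λ j → f (toℕ i) (toℕ j)))

at-gridFrom : ∀ (d : A) (f : ℕ → ℕ → A) {i j} → i < n → j < n → atℕ {n = n} d (gridFrom f) i j ≡ f i j
at-gridFrom {n = n} d f {i} {j} i<n j<n =
  trans (cong (λ r → lookupℕ d r j) (lookupℕ-tabulate {m = n} (replicate n d) (λ i → tabulate (λ j → f i (toℕ j))) i<n))
        (lookupℕ-tabulate d (f i) j<n)

grid-ext : ∀ (d : A) (D E : Grid A n) → (∀ {i j} → i < n → j < n → atℕ d D i j ≡ atℕ d E i j) → D ≡ E
grid-ext {n = n} d D E e = lookupℕ-ext (replicate n d) D E λ i<n → lookupℕ-ext d _ _ λ j<n → e i<n j<n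

at-in-range : ∀ (d : A) (D : Grid A n) {i j} → atℕ d D i j ≢ d → i < n × j < n
at-in-range {n = n} d D {i} {j} ne = ≰⇒> (λ n≤i → ne (row n≤i)) ,
  ≰⇒> (λ n≤j → ne (lookupℕ-beyond d (lookupℕ (replicate n d) D i) n≤j))
  where
  row : n ≤ i → atℕ d D i j ≡ d
  row n≤i rewrite lookupℕ-beyond (replicate n d) D n≤i = lookupℕ-replicate d n j

∸-suc-suc : ∀ {i n} → i < n → n ∸ i ≡ suc (n ∸ suc i)
∸-suc-suc {zero} {suc n} _ = refl
∸-suc-suc {suc i} {suc n} (s≤s i<n) = ∸-suc-suc i<n

flip-flip : ∀ {i n} → i < n → n ∸ suc (n ∸ suc i) ≡ i
flip-flip {i} {n} i<n = trans (cong (n ∸_) (sym (∸-suc-suc i<n))) (m∸[m∸n]≡n (<⇒≤ i<n))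

flip-< : ∀ {i n} → i < n → n ∸ suc i < n
flip-< {i} {suc n} _ = s≤s (m∸n≤m n i)

≤⇒downward : ∀ {n} (P : ℕ → Set) → P n → (∀ {i} → i < n → P (suc i) → P i) → ∀ {i} → i ≤ n → P i
≤⇒downward {n} P base step {i} i≤n = go (n ∸ i) (m+[n∸m]≡n i≤n)
  where
  go : ∀ d {i} → i + d ≡ n → P i
  go zero {i} e = subst P (trans (sym e) (+-identityʳ i)) base
  go (suc d) {i} e = step (subst (i <_) e (m<m+n i z<s)) (go d (trans (sym (+-suc i d)) e))

is-nothing : ∀ {x : Maybe A} → is-just x ≡ false → x ≡ nothing
is-nothing {x = nothing} _ = refl

is-just⇒just : ∀ {x : Maybe A} → is-just x ≡ true → ∃ λ a → x ≡ just a
is-just⇒just {x = just a} _ = a , refl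

nothing≢just : ∀ {x : Maybe A} {a} → x ≡ nothing → x ≢ just a
nothing≢just refl ()

false≢true : ∀ {b} → b ≡ false → b ≢ true
false≢true refl ()

northOut eastOut : BTile → Maybe ℕ → Maybe ℕ → Maybe ℕ
northOut bcross s w = s
northOut vert s w = s
northOut jT s w = w
northOut horiz s w = nothing
northOut rT s w = nothing
northOut blank s w = nothing
eastOut bcross s w = w
eastOut horiz s w = w
eastOut rT s w = s
eastOut vert s w = nothing
eastOut jT s w = nothing
eastOut blank s w = nothing

module BPDLabels {n : ℕ} (D : Grid BTile n) where
  open BPDPipes D public

  -- V i j is the label on the north edge of cell (i , j), H i j the one on its west edge.
  V H : ℕ → ℕ → Maybe ℕ
  V i j = bS (n ∸ i) j
  H i j = bW (n ∸ suc i) j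

  V-bottom : ∀ j → V n j ≡ just j
  V-bottom j = cong (λ b → bS b j) (n∸n≡0 n)

  bS-northOut : ∀ b j → bS (suc b) j ≡ northOut (tB (n ∸ suc b) j) (bS b j) (bW b j)
  bS-northOut b j with tB (n ∸ suc b) j
  ... | bcross = refl
  ... | horiz = refl
  ... | vert = refl
  ... | rT = refl
  ... | jT = refl
  ... | blank = refl

  bW-eastOut : ∀ b j → bW b (suc j) ≡ eastOut (tB (n ∸ suc b) j) (bS b j) (bW b j)
  bW-eastOut b j with tB (n ∸ suc b) j
  ... | bcross = refl
  ... | horiz = refl
  ... | vert = refl
  ... | rT = refl
  ... | jT = refl
  ... | blank = refl

  V-step : ∀ {i} j → i < n → V i j ≡ northOut (tB i j) (V (suc i) j) (H i j)
  V-step {i} j i<n = trans (cong (λ b → bS b j) (∸-suc-suc i<n)) (trans (bS-northOut (n ∸ suc i) j)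
    (cong (λ r → northOut (tB r j) (V (suc i) j) (H i j)) (flip-flip i<n)))

  H-step : ∀ {i} j → i < n → H i (suc j) ≡ eastOut (tB i j) (V (suc i) j) (H i j)
  H-step {i} j i<n = trans (bW-eastOut (n ∸ suc i) j)
    (cong (λ r → eastOut (tB r j) (V (suc i) j) (H i j)) (flip-flip i<n))

  module _ (tiling : IsBPDTiling D) where

    last-row : ∀ {j i} → i < n → ¬ suc i < n → j < n → hasS (tB i j) ≡ true
    last-row {j} {i} i<n i≮ j<n = subst (λ r → hasS (tB r j) ≡ true) (cong (_∸ 1) (≤-antisym (≮⇒≥ i≮) i<n))
      (proj₁ (proj₂ (proj₂ (proj₂ (proj₂ tiling)))) j j<n)

    last-col : ∀ {i j} → i < n → j < n → ¬ suc j < n → hasE (tB i j) ≡ true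
    last-col {i} {j} i<n j<n j≮ = subst (λ c → hasE (tB i c) ≡ true) (cong (_∸ 1) (≤-antisym (≮⇒≥ j≮) j<n))
      (proj₂ (proj₂ (proj₂ (proj₂ (proj₂ tiling)))) i i<n)

    -- Labels are computed by following pipes, whereas the tiling conditions speak of edges of
    -- tiles; here the two notions of an occupied edge are matched. `H-just` takes the south edges
    -- of its row as a hypothesis, so that the induction over rows in `V-just` can call it.
    V-just : ∀ {i} → i < n → ∀ {j} → j < n → is-just (V (suc i) j) ≡ hasS (tB i j)
    H-just : ∀ {i} → i < n → ∀ {j} → j < n →
      (∀ {j} → j < n → is-just (V (suc i) j) ≡ hasS (tB i j)) → is-just (H i j) ≡ hasW (tB i j)
    H-just {i} i<n {zero} 0<n vs = sym (proj₁ (proj₂ (proj₂ (proj₂ tiling))) i i<n)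
    H-just {i} i<n {suc j} sj<n vs rewrite H-step j i<n = trans (out (tB i j) refl) (proj₁ (proj₂ tiling) i j i<n sj<n)
      where
      j<n = <-trans (n<1+n j) sj<n
      IH = H-just i<n j<n vs
      out : ∀ t → tB i j ≡ t → is-just (eastOut (tB i j) (V (suc i) j) (H i j)) ≡ hasE (tB i j)
      out bcross e rewrite e = trans IH (cong hasW e)
      out horiz e rewrite e = trans IH (cong hasW e)
      out vert e rewrite e = refl
      out rT e rewrite e = trans (vs j<n) (cong hasS e)
      out jT e rewrite e = refl
      out blank e rewrite e = refl
    V-just {i} i<n = ≤⇒downward P (λ n<n → ⊥-elim (<-irrefl refl n<n)) step (<⇒≤ i<n) i<n
      where
      P : ℕ → Set
      P i = i < n → ∀ {j} → j < n → is-just (V (suc i) j) ≡ hasS (tB i j)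
      step : ∀ {i} → i < n → P (suc i) → P i
      step {i} i<n p _ {j} j<n with suc i <? n
      ... | no i≮ rewrite ≤-antisym i<n (≮⇒≥ i≮) | V-bottom j =
        sym (last-row i<n i≮ j<n)
      ... | yes si<n rewrite V-step j si<n = trans (out (tB (suc i) j) refl) (sym (proj₁ tiling i j si<n j<n))
        where
        out : ∀ t → tB (suc i) j ≡ t →
          is-just (northOut (tB (suc i) j) (V (suc (suc i)) j) (H (suc i) j)) ≡ hasN (tB (suc i) j)
        out bcross e rewrite e = trans (p si<n j<n) (cong hasS e)
        out horiz e rewrite e = refl
        out vert e rewrite e = trans (p si<n j<n) (cong hasS e)
        out rT e rewrite e = refl
        out jT e rewrite e = trans (H-just si<n j<n (p si<n)) (cong hasW e)
        out blank e rewrite e = refl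

    H-is-just : ∀ {i j} → i < n → j < n → is-just (H i j) ≡ hasW (tB i j)
    H-is-just i<n j<n = H-just i<n j<n (V-just i<n)

    H-is-just-east : ∀ {i j} → i < n → j < n → is-just (H i (suc j)) ≡ hasE (tB i j)
    H-is-just-east {i} {j} i<n j<n rewrite H-step j i<n with tB i j | V-just i<n j<n | H-is-just i<n j<n
    ... | bcross | _ | h = h
    ... | horiz | _ | h = h
    ... | vert | _ | _ = refl
    ... | rT | v | _ = v
    ... | jT | _ | _ = refl
    ... | blank | _ | _ = refl

    cellB : ∀ {i j} → i < n → j < n → Cell V H (tB i j ≡ bcross) i j
    cellB {i} {j} i<n j<n with tB i j | V-step j i<n | H-step j i<n | V-just i<n j<n | H-is-just i<n j<n
    ... | bcross | v | h | _ | _ = swapped (sym h) (sym v) (λ _ _ → refl)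
    ... | horiz | v | h | s | _ =
      swapped (sym h) (trans (is-nothing s) (sym v)) (λ e _ → ⊥-elim (nothing≢just v e))
    ... | vert | v | h | _ | w =
      swapped (trans (is-nothing w) (sym h)) (sym v) (λ _ e → ⊥-elim (nothing≢just h e))
    ... | rT | v | h | _ | w = straight (trans (is-nothing w) (sym v)) (sym h)
    ... | jT | v | h | s | _ = straight (sym v) (trans (is-nothing s) (sym h))
    ... | blank | v | h | s | w = straight (trans (is-nothing w) (sym v)) (trans (is-nothing s) (sym h))

-- Bumpless pipe dreams of Grassmannian permutations

record Edges (t : BTile) (N S E W : Bool) : Set where
  constructor edges
  field
    north≡ : hasN t ≡ N
    south≡ : hasS t ≡ S
    east≡  : hasE t ≡ E
    west≡  : hasW t ≡ W

module Labelled {n k : ℕ} {p q : ℕ → ℕ} (sh : Shuffle n k p q) (D : Grid BTile n) where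
  open Shuffle sh
  open BPDLabels D

  -- In the Rothe diagram pipe `j` climbs column `j`, turns in row `q j` and runs east. The row is
  -- described by its occupied edges, which determine the tiles. `SouthLabels i` concerns the edges
  -- between row `i` and the row above it; they are the south edges of the latter.
  RotheRow SouthLabels WestLabels : ℕ → Set
  RotheRow i = ∀ {j} → j < n → Edges (tB i j) (q j <ᵇ i) (q j <ᵇ suc i) (p i <ᵇ suc j) (p i <ᵇ j)
  SouthLabels i = ∀ {j} → j < n → V i j ≡ (if q j <ᵇ i then just j else nothing)
  WestLabels i = ∀ {j} → j ≤ n → H i j ≡ (if p i <ᵇ j then just (p i) else nothing)

  if-true : ∀ {b} {x y : Maybe ℕ} → b ≡ true → (if b then x else y) ≡ x
  if-true refl = refl

  if-false : ∀ {b} {x y : Maybe ℕ} → b ≡ false → (if b then x else y) ≡ y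
  if-false refl = refl

  bottomLabels : SouthLabels n
  bottomLabels {j} j<n = trans (V-bottom j) (sym (if-true (lt-true (q<n j<n))))

  westLabels : ∀ {i} → i < n → RotheRow i → SouthLabels (suc i) → WestLabels i
  westLabels i<n rothe south {zero} _ = refl
  westLabels {i} i<n rothe south {suc j} j<n rewrite H-step j i<n
    with tB i j | rothe j<n | westLabels i<n rothe south (<⇒≤ j<n) | south j<n
  ... | bcross | edges _ _ e w | h | _ = trans h (trans (if-true (sym w)) (sym (if-true (sym e))))
  ... | horiz | edges _ _ e w | h | _ = trans h (trans (if-true (sym w)) (sym (if-true (sym e))))
  ... | vert | edges _ _ e _ | _ | _ = sym (if-false (sym e))
  ... | jT | edges _ _ e _ | _ | _ = sym (if-false (sym e))
  ... | blank | edges _ _ e _ | _ | _ = sym (if-false (sym e))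
  ... | rT | edges _ s e w | _ | v = trans v (trans (if-true (sym s)) (trans (cong just j≡)
          (sym (if-true (sym e)))))
    where
    j≡ : j ≡ p i
    j≡ = ≤-antisym (≮⇒≥ (false-lt (sym w))) (≤-pred (true-lt (sym e)))

  northLabels : ∀ {i} → i < n → RotheRow i → SouthLabels (suc i) → SouthLabels i
  northLabels {i} i<n rothe south {j} j<n rewrite V-step j i<n
    with tB i j | rothe j<n | south j<n
  ... | bcross | edges nn s _ _ | v = trans v (trans (if-true (sym s)) (sym (if-true (sym nn))))
  ... | vert | edges nn s _ _ | v = trans v (trans (if-true (sym s)) (sym (if-true (sym nn))))
  ... | horiz | edges nn _ _ _ | _ = sym (if-false (sym nn))
  ... | rT | edges nn _ _ _ | _ = sym (if-false (sym nn))
  ... | blank | edges nn _ _ _ | _ = sym (if-false (sym nn))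
  ... | jT | edges nn s _ _ | _ = ⊥-elim (false-lt {q j} (sym s) (m<n⇒m<1+n (true-lt {q j} (sym nn))))

  module _ (tiling : IsBPDTiling D) {i : ℕ} (i<n : i < n) (k≤i : k ≤ i)
           (south : SouthLabels (suc i)) (exit : H i n ≡ just (p i)) where

    private
      pi<n = p<n i<n

      -- By `south`, a label entering the row from below equals its column, so `p i` can join the
      -- row only at column `p i`.
      label-left : ∀ {j} → j ≤ p i → H i j ≢ just (p i)
      label-left {suc j} j<pi e with tB i j | H-step j i<n | south (<-trans j<pi pi<n)
      ... | bcross | h | _ = label-left (<⇒≤ j<pi) (trans (sym h) e)
      ... | horiz | h | _ = label-left (<⇒≤ j<pi) (trans (sym h) e)
      ... | vert | h | _ = nothing≢just h e
      ... | jT | h | _ = nothing≢just h e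
      ... | blank | h | _ = nothing≢just h e
      ... | rT | h | v with q j <ᵇ suc i
      ... | true = <⇒≢ j<pi (just-injective (trans (sym v) (trans (sym h) e)))
      ... | false = nothing≢just v (trans (sym h) e)

      right : ∀ {j} → j ≤ n → p i < j → H i j ≡ just (p i)
      right = ≤⇒downward (λ j → p i < j → H i j ≡ just (p i)) (λ _ → exit) step
        where
        step : ∀ {j} → j < n → (p i < suc j → H i (suc j) ≡ just (p i)) → p i < j → H i j ≡ just (p i)
        step {j} j<n IH pi<j with IH (m<n⇒m<1+n pi<j)
        ... | e with tB i j | H-step j i<n | south j<n
        ... | bcross | h | _ = trans (sym h) e
        ... | horiz | h | _ = trans (sym h) e
        ... | vert | h | _ = ⊥-elim (nothing≢just h e)
        ... | jT | h | _ = ⊥-elim (nothing≢just h e)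
        ... | blank | h | _ = ⊥-elim (nothing≢just h e)
        ... | rT | h | v with q j <ᵇ suc i
        ... | true = ⊥-elim (>⇒≢ pi<j (just-injective (trans (sym v) (trans (sym h) e))))
        ... | false = ⊥-elim (nothing≢just v (trans (sym h) e))

      -- Since `k ≤ i`, a pipe exiting below row `i` has a label exceeding `p i`; hence every column
      -- left of `p i` is occupied from the south. With an empty east edge this leaves only a
      -- vertical tile, so emptiness spreads westwards from the turn at column `p i`.
      left : ∀ {j} → j ≤ p i → H i j ≡ nothing
      left = ≤⇒downward (λ j → H i j ≡ nothing) corner step
        where
        corner : H i (p i) ≡ nothing
        corner with right pi<n (n<1+n _)
        ... | e with tB i (p i) | H-step (p i) i<n | H-is-just tiling i<n pi<n
        ... | bcross | h | _ = ⊥-elim (label-left ≤-refl (trans (sym h) e))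
        ... | horiz | h | _ = ⊥-elim (label-left ≤-refl (trans (sym h) e))
        ... | vert | h | _ = ⊥-elim (nothing≢just h e)
        ... | jT | h | _ = ⊥-elim (nothing≢just h e)
        ... | blank | h | _ = ⊥-elim (nothing≢just h e)
        ... | rT | _ | w = is-nothing w
        step : ∀ {j} → j < p i → H i (suc j) ≡ nothing → H i j ≡ nothing
        step {j} j<pi e = go (V-just tiling i<n j<n) (H-is-just tiling i<n j<n) (H-is-just-east tiling i<n j<n)
          where
          j<n = <-trans j<pi pi<n
          qj≤i : q j < suc i
          qj≤i = s≤s (≮⇒≥ (λ i<qj → <-asym j<pi (right-of-bound k≤i i<n j<n i<qj)))
          vj : V (suc i) j ≡ just j
          vj = trans (south j<n) (if-true (lt-true qj≤i))
          go : is-just (V (suc i) j) ≡ hasS (tB i j) → is-just (H i j) ≡ hasW (tB i j) →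
            is-just (H i (suc j)) ≡ hasE (tB i j) → H i j ≡ nothing
          go s w e' rewrite vj | e with tB i j
          go s w () | bcross
          go s w () | horiz
          go s w () | rT
          go () w e' | jT
          go () w e' | blank
          go s w e' | vert = is-nothing w

      west-just : ∀ {j} → j ≤ n → is-just (H i j) ≡ (p i <ᵇ j)
      west-just {j} j≤n with p i <? j
      ... | yes l = trans (cong is-just (right j≤n l)) (sym (lt-true l))
      ... | no ¬l = trans (cong is-just (left (≮⇒≥ ¬l))) (sym (lt-false ¬l))

      south-just : ∀ {j} → j < n → is-just (V (suc i) j) ≡ (q j <ᵇ suc i)
      south-just {j} j<n rewrite south j<n with q j <ᵇ suc i
      ... | true = refl
      ... | false = refl

    forcedRow : RotheRow i
    forcedRow {j} j<n = edges north s e w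
      where
      s = trans (sym (V-just tiling i<n j<n)) (south-just j<n)
      w = trans (sym (H-is-just tiling i<n j<n)) (west-just (<⇒≤ j<n))
      e = trans (sym (H-is-just-east tiling i<n j<n)) (west-just j<n)
      q≢i : j ≢ p i → q j ≢ i
      q≢i j≢ e = j≢ (trans (sym (pq j<n)) (cong p e))
      below : j ≢ p i → (q j <ᵇ suc i) ≡ true → (q j <ᵇ i) ≡ true
      below j≢ l = lt-true (≤∧≢⇒< (≤-pred (true-lt l)) (q≢i j≢))
      above : (q j <ᵇ suc i) ≡ false → (q j <ᵇ i) ≡ false
      above ¬l = lt-false (false-lt {q j} ¬l ∘ m<n⇒m<1+n)
      north : hasN (tB i j) ≡ (q j <ᵇ i)
      north with tB i j | s | e | w
      ... | bcross | s | _ | w = sym (below (>⇒≢ (true-lt (sym w))) (sym s))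
      ... | horiz | s | _ | _ = sym (above (sym s))
      ... | blank | s | _ | _ = sym (above (sym s))
      ... | vert | s | e | _ = sym (below (<⇒≢ (≮⇒≥ (false-lt (sym e)))) (sym s))
      ... | jT | s | e | w = ⊥-elim (false-lt {p i} (sym e) (m<n⇒m<1+n (true-lt {p i} (sym w))))
      ... | rT | s | e | w = sym (lt-false (λ l → <-irrefl (trans (cong q j≡) (qp i<n)) l))
        where
        j≡ : j ≡ p i
        j≡ = ≤-antisym (≮⇒≥ (false-lt (sym w))) (≤-pred (true-lt (sym e)))

  -- Equivalent to being a reduced bumpless pipe dream of the permutation, by `reduced⇒normal`,
  -- `normal⇒exits` and `normal⇒reduced`. All arguments about the flip of a bumpless pipe dream and
  -- about droops use this form, which can be checked tile by tile.
  record Normal : Set where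
    field
      tiling    : IsBPDTiling D
      rothe     : ∀ {i} → k ≤ i → i < n → RotheRow i
      uncrossed : ∀ {i j} → i < k → j < n → tB i j ≢ bcross

  southLabels : (∀ {i} → k ≤ i → i < n → RotheRow i) → ∀ {i} → k ≤ i → i ≤ n → SouthLabels i
  southLabels rothe k≤i i≤n = ≤⇒downward (λ i → k ≤ i → SouthLabels i) (λ _ → bottomLabels)
    (λ i<n south k≤i → northLabels i<n (rothe k≤i i<n) (south (m≤n⇒m≤1+n k≤i))) i≤n k≤i

  module Front (tiling : IsBPDTiling D) where
    open Network n V H (λ i j → tB i j ≡ bcross) (cellB tiling) public

    V-top : ∀ {j} → j < n → V 0 j ≡ nothing
    V-top {j} j<n with tB 0 j | V-step j (≤-<-trans z≤n j<n) | proj₁ (proj₂ (proj₂ tiling)) j j<n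
    ... | horiz | v | _ = v
    ... | rT | v | _ = v
    ... | blank | v | _ = v

    top-exit : ∀ {x a} → At 0 n x a → ∃ λ r → r < n × x ≡ r + n × H r n ≡ just a
    top-exit (north t t<n _ e) = ⊥-elim (nothing≢just (V-top t<n) e)
    top-exit (here 0<n x≡ e) = 0 , 0<n , x≡ , e
    top-exit (south t n≤t t<n _ _) = ⊥-elim (<⇒≱ t<n n≤t)
    top-exit (east r _ r<n x≡ e) = r , r<n , x≡ , e

    exit-top : ∀ {r a} → r < n → H r n ≡ just a → At 0 n (r + n) a
    exit-top {zero} r<n e = here r<n refl e
    exit-top {suc r} r<n e = east (suc r) z<s r<n refl e

    bottom-label : ∀ {x a} → At n n x a → x ≡ n + a
    bottom-label (north t t<n x≡ e) =
      trans x≡ (cong (n +_) (just-injective (trans (sym (V-bottom t)) e)))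
    bottom-label (here n<n _ _) = ⊥-elim (<-irrefl refl n<n)
    bottom-label (south t n≤t t<n _ _) = ⊥-elim (<⇒≱ t<n n≤t)
    bottom-label (east r n<r r<n _ _) = ⊥-elim (<-asym n<r r<n)

    bottom-sorted : ∀ {a b} → Ord n n a b → a < b
    bottom-sorted (x , y , x<y , p , q) =
      +-cancelˡ-< n _ _ (subst₂ _<_ (bottom-label p) (bottom-label q) x<y)

    cross-labels : ∀ {i j} → i < n → j < n → tB i j ≡ bcross → ∃₂ (Cross i j)
    cross-labels {i} {j} i<n j<n e
      with is-just⇒just (trans (V-just tiling i<n j<n) (cong hasS e))
         | is-just⇒just (trans (H-is-just tiling i<n j<n) (cong hasW e))
    ... | a , v | b , h = a , b , e ,
      (trans (V-step j i<n) (trans (cong (λ t → northOut t (V (suc i) j) (H i j)) e) v) ,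
       trans (H-step j i<n) (trans (cong (λ t → eastOut t (V (suc i) j) (H i j)) e) h)) , h , v

  ExitsInOrder : Set
  ExitsInOrder = ∀ {i} → i < n → H i n ≡ just (p i)

  module _ (tiling : IsBPDTiling D) (reduced : BPDReduced D) (exit : ExitsInOrder) where
    open Front tiling

    private
      unique : ∀ {i j i' j' a b a' b'} → Cross i j a b → Cross i' j' a' b' →
        SamePair a b a' b' → i ≡ i' × j ≡ j'
      unique (x , _ , w , s) (x' , _ , w' , s') (inj₁ (refl , refl)) =
        reduced _ _ _ _ x x' (inj₁ (trans s (sym s') , trans w (sym w')))
      unique (x , _ , w , s) (x' , _ , w' , s') (inj₂ (refl , refl)) =
        reduced _ _ _ _ x x' (inj₂ (trans s (sym w') , trans w (sym s')))

      -- The two labels `p r` and `p s` form an inversion, and the one leaving the cross eastwards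
      -- is the late one, `p s`. The cell lies above its exit row `s`, so the front at the cell
      -- contains it twice: on the east edge of the cell and on the east border in row `s`. Carried
      -- down to the bottom front, this is absurd.
      uncrossed : ∀ {i j} → i < k → j < n → tB i j ≢ bcross
      uncrossed {i} {j} i<k j<n x with cross-labels i<n j<n x
        where i<n = <-≤-trans i<k k≤n
      ... | a , b , c with crossing-inverts unique i<n j<n c
        where i<n = <-≤-trans i<k k≤n
      ... | (x , y , x<y , at-a , at-b) , ba@(_ , _ , _ , at-b' , at-a')
        with r , r<n , refl , ra ← top-exit at-a | s , s<n , refl , sb ← top-exit at-b
        with refl ← just-injective (trans (sym (exit r<n)) ra)
           | refl ← just-injective (trans (sym (exit s<n)) sb) =
        <-irrefl refl (bottom-sorted (descend i<n j<n selfless twice))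
        where
        i<n = <-≤-trans i<k k≤n
        k≤s : k ≤ s
        k≤s = subst (k ≤_) (qp s<n) (proj₂ (inversion (p<n s<n) (p<n r<n) (bottom-sorted ba)
          (subst₂ _<_ (sym (qp r<n)) (sym (qp s<n)) (+-cancelʳ-< n r s x<y))))
        twice : Ord i (suc j) (p s) (p s)
        twice = i + suc j , s + n , +-mono-<-≤ (<-≤-trans i<k k≤s) j<n ,
          here i<n refl (proj₂ (proj₁ (proj₂ c))) , east s (<-≤-trans i<k k≤s) s<n refl (exit s<n)
        selfless : ∀ {r l} → r < n → l < n → i < r ⊎ (r ≡ i × l < suc j) → ¬ Cross r l (p s) (p s)
        selfless r<n l<n _ c = <-irrefl refl (bottom-sorted (proj₂ (crossing-inverts unique r<n l<n c)))

    reduced⇒normal : Normal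
    reduced⇒normal = record
      { tiling = tiling
      ; rothe = λ k≤i i<n → forcedRow tiling i<n k≤i (labelsV (m≤n⇒m≤1+n k≤i) i<n) (exit i<n)
      ; uncrossed = uncrossed
      }
      where
      labelsV : ∀ {i} → k ≤ i → i ≤ n → SouthLabels i
      labelsV k≤i i≤n = ≤⇒downward (λ i → k ≤ i → SouthLabels i) (λ _ → bottomLabels)
        (λ i<n IH k≤i → let v = IH (m≤n⇒m≤1+n k≤i)
                        in northLabels i<n (forcedRow tiling i<n k≤i v (exit i<n)) v) i≤n k≤i

  module _ (normal : Normal) where
    open Normal normal
    open Front tiling

    private
      labelsV : ∀ {i} → k ≤ i → i ≤ n → SouthLabels i
      labelsV = southLabels rothe

      labelsH : ∀ {i} → k ≤ i → i < n → WestLabels i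
      labelsH k≤i i<n = westLabels i<n (rothe k≤i i<n) (labelsV (m≤n⇒m≤1+n k≤i) i<n)

      FirstRows : Maybe ℕ → Set
      FirstRows x = ∀ {l} → x ≡ just l → l < n × q l < k

      none : ∀ {x} → x ≡ nothing → FirstRows x
      none refl ()

      firstH : ∀ {i} → i < k → (∀ {j} → j < n → FirstRows (V (suc i) j)) → ∀ {j} → j ≤ n → FirstRows (H i j)
      firstH i<k v {zero} _ = none refl
      firstH {i} i<k v {suc j} j<n with tB i j | H-step j (<-≤-trans i<k k≤n)
      ... | bcross | h = subst FirstRows (sym h) (firstH i<k v (<⇒≤ j<n))
      ... | horiz | h = subst FirstRows (sym h) (firstH i<k v (<⇒≤ j<n))
      ... | rT | h = subst FirstRows (sym h) (v j<n)
      ... | vert | h = none h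
      ... | jT | h = none h
      ... | blank | h = none h

      -- The rows before `k` only pass on the labels that enter them from row `k`, and by the Rothe
      -- form below these are the early ones.
      firstV : ∀ {i} → i ≤ k → ∀ {j} → j < n → FirstRows (V i j)
      firstV = ≤⇒downward (λ i → ∀ {j} → j < n → FirstRows (V i j)) base step
        where
        base : ∀ {j} → j < n → FirstRows (V k j)
        base {j} j<n e with q j <ᵇ k in qj | labelsV ≤-refl k≤n j<n
        ... | false | v = ⊥-elim (nothing≢just v e)
        ... | true | v with refl ← just-injective (trans (sym v) e) = j<n , true-lt qj
        step : ∀ {i} → i < k → (∀ {j} → j < n → FirstRows (V (suc i) j)) → ∀ {j} → j < n → FirstRows (V i j)
        step {i} i<k v {j} j<n with tB i j | V-step j (<-≤-trans i<k k≤n)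
        ... | bcross | e = subst FirstRows (sym e) (v j<n)
        ... | vert | e = subst FirstRows (sym e) (v j<n)
        ... | jT | e = subst FirstRows (sym e) (firstH i<k v (<⇒≤ j<n))
        ... | horiz | e = none e
        ... | rT | e = none e
        ... | blank | e = none e

      low-cross : ∀ {i j} → i < n → j < n → tB i j ≡ bcross →
        k ≤ i × p i < j × q j < i × V (suc i) j ≡ just j × H i j ≡ just (p i)
      low-cross {i} {j} i<n j<n x with k ≤? i
      ... | no k≰i = ⊥-elim (uncrossed (≰⇒> k≰i) j<n x)
      ... | yes k≤i with rothe k≤i i<n j<n
      ... | edges nn s _ w = k≤i , true-lt (trans (sym w) (cong hasW x)) , true-lt (trans (sym nn) (cong hasN x)) ,
        trans (labelsV (m≤n⇒m≤1+n k≤i) i<n j<n) (if-true (trans (sym s) (cong hasS x))) ,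
        trans (labelsH k≤i i<n (<⇒≤ j<n)) (if-true (trans (sym w) (cong hasW x)))

      exit-just : ∀ {i} → i < n → is-just (H i n) ≡ true
      exit-just {i} i<n = subst (λ m → is-just (H i m) ≡ true) (sym n≡)
        (trans (H-is-just-east tiling i<n (subst (n ∸ 1 <_) (sym n≡) ≤-refl))
               (proj₂ (proj₂ (proj₂ (proj₂ (proj₂ tiling)))) i i<n))
        where n≡ = ∸-suc-suc (≤-<-trans z≤n i<n)

      label : ℕ → ℕ
      label i = fromMaybe 0 (H i n)

      label≡ : ∀ {i} → i < n → H i n ≡ just (label i)
      label≡ {i} i<n with H i n | exit-just i<n
      ... | just _ | _ = refl

      label-first : ∀ {i} → i < k → label i < n × q (label i) < k
      label-first i<k = firstH i<k (firstV i<k) ≤-refl (label≡ (<-≤-trans i<k k≤n))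

      -- Every cross lies in a late row `r` and its horizontal pipe is the late pipe `p r`. Two
      -- early pipes therefore keep their order from the exits down to the south border, where
      -- position is label.
      label-increasing : ∀ {i i'} → i < i' → i' < k → label i < label i'
      label-increasing {i} {i'} i<i' i'<k =
        bottom-sorted (descend (≤-<-trans z≤n i<n) ≤-refl free
          (i + n , i' + n , +-monoˡ-< n i<i' , exit-top i<n (label≡ i<n) , exit-top i'<n (label≡ i'<n)))
        where
        i'<n = <-≤-trans i'<k k≤n
        i<n = <-trans i<i' i'<n
        free : ∀ {r l} → r < n → l < n → 0 < r ⊎ (r ≡ 0 × l < n) → ¬ Cross r l (label i) (label i')
        free r<n l<n _ (x , _ , w , _) with k≤r , _ , _ , _ , h ← low-cross r<n l<n x =
          <⇒≱ (proj₂ (label-first i'<k)) (subst (k ≤_)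
            (trans (sym (qp r<n)) (cong q (just-injective (trans (sym h) w)))) k≤r)

    normal⇒exits : ExitsInOrder
    normal⇒exits {i} i<n with k ≤? i
    ... | yes k≤i = trans (labelsH k≤i i<n ≤-refl) (if-true (lt-true (p<n i<n)))
    ... | no k≰i = trans (label≡ i<n) (cong just (trans (sym (pq (proj₁ (label-first i<k))))
          (cong p (increasing-self-map {λ i → q (label i)} {0} {k}
            (λ _ i<k → z≤n , proj₂ (label-first i<k))
            (λ _ i<i' i'<k → q-increasing (proj₁ (label-first (<-trans i<i' i'<k)))
              (proj₁ (label-first i'<k)) (label-increasing i<i' i'<k) (inj₁ (proj₂ (label-first (<-trans i<i' i'<k)))))
            z≤n i<k))))
      where i<k = ≰⇒> k≰i

    -- A cross at `(i , j)` carries `j` vertically and `p i` horizontally, so its labels give back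
    -- the cell. In the swapped case `j ≡ p i'`; the cross then gives `i' < i` and `p i < p i'`,
    -- against the increase of `p` on the late rows.
    normal⇒reduced : BPDReduced D
    normal⇒reduced i j i' j' x x' same
      with i<n , j<n ← at-in-range blank D {i} {j} (λ e → case trans (sym x) e of λ ())
         | i'<n , j'<n ← at-in-range blank D {i'} {j'} (λ e → case trans (sym x') e of λ ())
      with k≤i , pi<j , qj<i , s , w ← low-cross i<n j<n x
         | k≤i' , _ , _ , s' , w' ← low-cross i'<n j'<n x'
      with same
    ... | inj₁ (e , e') =
      trans (sym (qp i<n)) (trans (cong q (just-injective (trans (sym w) (trans e' w')))) (qp i'<n)) ,
      just-injective (trans (sym s) (trans e s'))
    ... | inj₂ (e , _) with refl ← just-injective (trans (sym s) (trans e w')) =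
      ⊥-elim (<-asym pi<j (incB k≤i' (subst (_< i) (qp i'<n) qj<i) i<n))

-- Pipe dreams of Grassmannian permutations

module PDLabels {n : ℕ} (P : Grid PDTile n) where
  open PDPipes P public

  -- West edges indexed by column rather than by distance from the east border.
  pdW : ℕ → ℕ → Maybe ℕ
  pdW i j = pdWest i (n ∸ j)

  pdW-east : ∀ i → pdW i n ≡ nothing
  pdW-east i = cong (pdWest i) (n∸n≡0 n)

  pdW-step : ∀ i {j} → j < n → pdW i j ≡ (if isCrossP (tP i j) then pdW i (suc j) else pdN i j)
  pdW-step i {j} j<n = trans (cong (pdWest i) (∸-suc-suc j<n))
    (cong (λ c → if isCrossP (tP i c) then pdW i (suc j) else pdN i c) (flip-flip j<n))

  pdN-cross : ∀ {i j} → tP i j ≡ cross → pdN (suc i) j ≡ pdN i j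
  pdN-cross {i} {j} x = cong (λ t → if isCrossP t then pdN i j else pdW i (suc j)) x

  pdN-elbow : ∀ {i j} → tP i j ≡ elbow → pdN (suc i) j ≡ pdW i (suc j)
  pdN-elbow {i} {j} x = cong (λ t → if isCrossP t then pdN i j else pdW i (suc j)) x

  pdW-cross : ∀ {i j} → j < n → tP i j ≡ cross → pdW i j ≡ pdW i (suc j)
  pdW-cross {i} {j} j<n x =
    trans (pdW-step i j<n) (cong (λ t → if isCrossP t then pdW i (suc j) else pdN i j) x)

  pdW-elbow : ∀ {i j} → j < n → tP i j ≡ elbow → pdW i j ≡ pdN i j
  pdW-elbow {i} {j} j<n x =
    trans (pdW-step i j<n) (cong (λ t → if isCrossP t then pdW i (suc j) else pdN i j) x)

  cellP : ∀ {i j} → i < n → j < n → Cell pdN pdW (tP i j ≡ cross) i j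
  cellP {i} {j} _ j<n with tP i j in t
  ... | cross = swapped (pdW-cross j<n t) (pdN-cross t) (λ _ _ → refl)
  ... | elbow = straight (pdW-elbow j<n t) (pdN-elbow t)

  open Network n pdN pdW (λ i j → tP i j ≡ cross) cellP public

  AllBelow : Maybe ℕ → Set
  AllBelow x = ∀ {l} → x ≡ just l → l < n

  mutual
    belowN : ∀ i {j} → j < n → AllBelow (pdN i j)
    belowN zero j<n refl = j<n
    belowN (suc i) {j} j<n with tP i j
    ... | cross = belowN i j<n
    ... | elbow = belowW i j<n

    belowW : ∀ i {j} → j ≤ n → AllBelow (pdW i j)
    belowW i = ≤⇒downward (λ j → AllBelow (pdW i j)) (λ e → ⊥-elim (nothing≢just (pdW-east i) e)) step
      where
      step : ∀ {j} → j < n → AllBelow (pdW i (suc j)) → AllBelow (pdW i j)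
      step {j} j<n IH with tP i j | pdW-step i j<n
      ... | cross | w = subst AllBelow (sym w) IH
      ... | elbow | w = subst AllBelow (sym w) (belowN i j<n)

  top-label : ∀ {x a} → At 0 n x a → x ≡ a
  top-label (north t _ x≡ e) = trans x≡ (just-injective e)
  top-label (here _ _ e) = ⊥-elim (nothing≢just (pdW-east 0) e)
  top-label (south t n≤t t<n _ _) = ⊥-elim (<⇒≱ t<n n≤t)
  top-label (east r _ _ _ e) = ⊥-elim (nothing≢just (pdW-east r) e)

  top-sorted : ∀ {a b} → Ord 0 n a b → a < b
  top-sorted (_ , _ , x<y , p , q) = subst₂ _<_ (top-label p) (top-label q) x<y

  module _ (isPD : IsPD P) where

    cross-in-triangle : ∀ {i j} → tP i j ≡ cross → i < n × j < n × suc (i + j) < n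
    cross-in-triangle {i} {j} x with at-in-range elbow P {i} {j} (λ e → case trans (sym x) e of λ ())
    ... | i<n , j<n = i<n , j<n , subst (_< n) (+-comm (i + j) 1) (≰⇒> λ far →
      case trans (sym x) (isPD i j i<n j<n far) of λ ())

    mutual
      justN : ∀ i j → i + j < n → is-just (pdN i j) ≡ true
      justN zero j _ = refl
      justN (suc i) j lt with tP i j
      ... | cross = justN i j (<-trans (n<1+n _) lt)
      ... | elbow = justW i (suc j) (n ∸ suc (suc i + j))
        (trans (cong (_+ (n ∸ suc (suc i + j))) (cong suc (+-suc i j))) (m+[n∸m]≡n lt))

      -- `d` is the distance of the cell from the antidiagonal. Going east through crosses meets an
      -- elbow there at the latest, and the label is then read off a north edge.
      justW : ∀ i j d → suc (i + j) + d ≡ n → is-just (pdW i j) ≡ true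
      justW i j d e with tP i j in t | pdW-step i (≤-<-trans (m≤n+m j i) (m+n≤o⇒m≤o _ (≤-reflexive e)))
      ... | elbow | w = trans (cong is-just w) (justN i j (m+n≤o⇒m≤o _ (≤-reflexive e)))
      justW i j zero e | cross | w = ⊥-elim (<-irrefl (trans (sym (+-identityʳ _)) e) (proj₂ (proj₂ (cross-in-triangle t))))
      justW i j (suc d) e | cross | w = trans (cong is-just w)
        (justW i (suc j) d (trans (cong (λ m → suc (m + d)) (+-suc i j)) (trans (sym (+-suc (suc (i + j)) d)) e)))

    cross-labels : ∀ {i j} → tP i j ≡ cross → ∃₂ (Cross i j)
    cross-labels {i} {j} x with i<n , j<n , lt ← cross-in-triangle x
      with is-just⇒just (justN i j (<-trans (n<1+n _) lt))
         | is-just⇒just (justW i (suc j) (n ∸ suc (suc (i + j)))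
             (trans (cong (λ m → suc m + (n ∸ suc (suc (i + j)))) (+-suc i j)) (m+[n∸m]≡n lt)))
    ... | a , na | b , eb = a , b , x , (na , eb) ,
      trans (pdW-cross j<n x) eb , trans (pdN-cross x) na

module Pipes {n k : ℕ} {p q : ℕ → ℕ} (sh : Shuffle n k p q) (P : Grid PDTile n) where
  open Shuffle sh
  open PDLabels P

  -- The value at `nothing` matters: the east border of a pipe dream carries no pipe, and a west or
  -- east edge that is not early corresponds to an occupied edge, as the east border of a bumpless
  -- pipe dream demands.
  early : Maybe ℕ → Bool
  early nothing = false
  early (just l) = q l <ᵇ k

  ExitsInOrder : Set
  ExitsInOrder = ∀ {i} → i < n → pdW i 0 ≡ just (p i)

  module _ (isPD : IsPD P) (reduced : PDReduced P) (exit : ExitsInOrder) where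

    private
      unique : ∀ {i j i' j' a b a' b'} → Cross i j a b → Cross i' j' a' b' →
        SamePair a b a' b' → i ≡ i' × j ≡ j'
      unique (x , (m , e) , _) (x' , (m' , e') , _) (inj₁ (refl , refl)) =
        reduced _ _ _ _ x x' (inj₁ (trans m (sym m') , trans e (sym e')))
      unique (x , (m , e) , _) (x' , (m' , e') , _) (inj₂ (refl , refl)) =
        reduced _ _ _ _ x x' (inj₂ (trans m (sym e') , trans e (sym m')))

      selfless : ∀ {i j c} → i < n → j < n → ¬ Cross i j c c
      selfless i<n j<n x = <-irrefl refl (top-sorted (proj₁ (crossing-inverts unique i<n j<n x)))

      irreflexive : ∀ {i j c} → i ≤ n → (j < n → i < n) → j ≤ n → ¬ Ord i j c c
      irreflexive i≤n valid j≤n o = <-irrefl refl (top-sorted (ascend i≤n valid j≤n (λ r<n l<n _ → selfless r<n l<n) o))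

      exit-at : ∀ {c} → c < n → pdW (q c) 0 ≡ just c
      exit-at c<n = trans (exit (q<n c<n)) (cong just (pq c<n))

      exit-position : ∀ {x c} → c < n → At n n x c → x ≡ q c
      exit-position c<n at = position-unique (irreflexive ≤-refl (λ z → z) ≤-refl) at
        (west (q<n c<n) (exit-at c<n))

    cross-late-early : ∀ {i j a b} → Cross i j a b → k ≤ q a × q b < k
    cross-late-early {i} {j} c@(x , (na , eb) , _) with i<n , j<n , _ ← cross-in-triangle isPD x
      with o , (_ , _ , x<y , at-b , at-a) ← crossing-inverts unique i<n j<n c
      with qb<k , k≤qa ← inversion (belowN i j<n na) (belowW i j<n eb) (top-sorted o)
             (subst₂ _<_ (exit-position (belowW i j<n eb) at-b) (exit-position (belowN i j<n na) at-a) x<y) =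
      k≤qa , qb<k

    -- The pipe entering a cross from the east is early. In a late row it has already left, so the
    -- front at the cell would contain it twice: on the west border in row `q b` and on the east
    -- edge of the cell.
    late-rows-uncrossed : ∀ {i j} → k ≤ i → tP i j ≢ cross
    late-rows-uncrossed {i} {j} k≤i x with i<n , j<n , _ ← cross-in-triangle isPD x
      with a , b , c@(_ , (_ , eb) , _) ← cross-labels isPD x =
      irreflexive (<⇒≤ i<n) (λ _ → i<n) j<n
        (q b , i + suc j , <-≤-trans qb<i (m≤m+n i (suc j)) , west qb<i (exit-at (belowW i j<n eb)) , here i<n refl eb)
      where
      qb<i : q b < i
      qb<i = <-≤-trans (proj₂ (cross-late-early c)) k≤i

    early-gone : ∀ {j} → j < n → early (pdN k j) ≡ false
    early-gone {j} j<n with pdN k j in e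
    ... | nothing = refl
    ... | just b with q b <ᵇ k in l
    ... | false = refl
    ... | true = ⊥-elim (irreflexive k≤n (λ n<n → ⊥-elim (<-irrefl refl n<n)) ≤-refl
          (q b , k + j , <-≤-trans (true-lt l) (m≤m+n k j) ,
           west (true-lt l) (exit-at (belowN k j<n e)) , north j j<n refl e))

-- The flip and its inverse

isBlank : BTile → Bool
isBlank bcross = false
isBlank horiz = false
isBlank vert = false
isBlank rT = false
isBlank jT = false
isBlank blank = true

-- The flags say whether the pipes on the north and east edges of the pipe dream tile exit early.
unflipTile : PDTile → Bool → Bool → BTile
unflipTile cross _ _ = blank
unflipTile elbow true true = vert
unflipTile elbow true false = rT
unflipTile elbow false true = jT
unflipTile elbow false false = horiz

flipTile : BTile → PDTile
flipTile t = if isBlank t then cross else elbow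

flip-unflip : ∀ t b c → flipTile (unflipTile t b c) ≡ t
flip-unflip cross b c = refl
flip-unflip elbow true true = refl
flip-unflip elbow true false = refl
flip-unflip elbow false true = refl
flip-unflip elbow false false = refl

-- An elbow sends its north pipe west and its east pipe south; turned upside down, the north edge
-- thus takes the flag of the east pipe. The negations occur because occupied horizontal passages
-- correspond to pipes that are not early.
elbowEdges : ∀ b c → Edges (unflipTile elbow b c) c b (not c) (not b)
elbowEdges true true = edges refl refl refl refl
elbowEdges true false = edges refl refl refl refl
elbowEdges false true = edges refl refl refl refl
elbowEdges false false = edges refl refl refl refl

blankEdges : ∀ {b c} → b ≡ false → c ≡ true → Edges (unflipTile cross b c) b b (not c) (not c)
blankEdges refl refl = edges refl refl refl refl

flip-blank : ∀ {t} → flipTile t ≡ cross → t ≡ blank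
flip-blank {blank} _ = refl

module Flip {n k : ℕ} {p q : ℕ → ℕ} (sh : Shuffle n k p q) where
  open Shuffle sh

  -- In a late row every `j < p i` has `q j < i`, so all tiles left of `p i` are vertical and the
  -- row has no blanks.
  rotheTile : ℕ → ℕ → BTile
  rotheTile i j with <-cmp j (p i)
  ... | tri< _ _ _ = vert
  ... | tri≈ _ _ _ = rT
  ... | tri> _ _ _ = if q j <ᵇ i then bcross else horiz

  rotheEdges : ∀ {i j} → k ≤ i → i < n → j < n →
    Edges (rotheTile i j) (q j <ᵇ i) (q j <ᵇ suc i) (p i <ᵇ suc j) (p i <ᵇ j)
  rotheEdges {i} {j} k≤i i<n j<n with <-cmp j (p i)
  ... | tri< j<pi _ _ = edges (sym (lt-true qj<i)) (sym (lt-true (m<n⇒m<1+n qj<i)))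
          (sym (lt-false (λ l → <⇒≱ j<pi (≤-pred l)))) (sym (lt-false (<-asym j<pi)))
    where
    qj<i : q j < i
    qj<i = ≤∧≢⇒< (≮⇒≥ (λ i<qj → <-asym j<pi (right-of-bound k≤i i<n j<n i<qj)))
      (λ e → <⇒≢ j<pi (trans (sym (pq j<n)) (cong p e)))
  ... | tri≈ _ refl _ = edges (sym (lt-false (λ l → <-irrefl (qp i<n) l)))
          (sym (lt-true (subst (_< suc i) (sym (qp i<n)) ≤-refl)))
          (sym (lt-true {j} ≤-refl)) (sym (lt-false {j} (<-irrefl refl)))
  ... | tri> _ j≢pi pi<j with q j <ᵇ i in l
  ... | true = edges refl (sym (lt-true (m<n⇒m<1+n (true-lt {q j} l))))
          (sym (lt-true (m<n⇒m<1+n pi<j))) (sym (lt-true pi<j))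
  ... | false = edges refl (sym (lt-false (λ qj≤i → false-lt {q j} l (≤∧≢⇒< (≤-pred qj≤i)
          (λ e → j≢pi (trans (sym (pq j<n)) (cong p e)))))))
          (sym (lt-true (m<n⇒m<1+n pi<j))) (sym (lt-true pi<j))

  flipGrid : Grid BTile n → Grid PDTile n
  flipGrid D = gridFrom λ r j → if r <ᵇ k then flipTile (atℕ blank D (k ∸ suc r) j) else elbow

  at-flip-early : ∀ D {r j} → r < k → j < n → atℕ elbow (flipGrid D) r j ≡ flipTile (atℕ blank D (k ∸ suc r) j)
  at-flip-early D {r} {j} r<k j<n = trans (at-gridFrom elbow _ (<-≤-trans r<k k≤n) j<n)
    (cong (λ b → if b then flipTile (atℕ blank D (k ∸ suc r) j) else elbow) (lt-true r<k))

  at-flip-late : ∀ D {r j} → k ≤ r → r < n → j < n → atℕ elbow (flipGrid D) r j ≡ elbow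
  at-flip-late D {r} {j} k≤r r<n j<n = trans (at-gridFrom elbow _ r<n j<n)
    (cong (λ b → if b then flipTile (atℕ blank D (k ∸ suc r) j) else elbow) (lt-false (≤⇒≯ k≤r)))

  module _ (P : Grid PDTile n) where
    open PDLabels P
    open Pipes sh P

    unflipGrid : Grid BTile n
    unflipGrid = gridFrom λ i j → if i <ᵇ k
      then unflipTile (tP (k ∸ suc i) j) (early (pdN (k ∸ suc i) j)) (early (pdW (k ∸ suc i) (suc j)))
      else rotheTile i j

    private
      t : ℕ → ℕ → BTile
      t = atℕ blank unflipGrid

    module _ (isPD : IsPD P) (reduced : PDReduced P) (exit : ExitsInOrder) where

      private
        at-early : ∀ {i j} → i < k → j < n →
          t i j ≡ unflipTile (tP (k ∸ suc i) j) (early (pdN (k ∸ suc i) j)) (early (pdW (k ∸ suc i) (suc j)))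
        at-early {i} {j} i<k j<n = trans (at-gridFrom blank _ (<-≤-trans i<k k≤n) j<n)
          (cong (λ b → if b then unflipTile (tP (k ∸ suc i) j) (early (pdN (k ∸ suc i) j)) (early (pdW (k ∸ suc i) (suc j)))
                       else rotheTile i j) (lt-true i<k))

        at-late : ∀ {i j} → k ≤ i → i < n → j < n → t i j ≡ rotheTile i j
        at-late {i} {j} k≤i i<n j<n = trans (at-gridFrom blank _ i<n j<n)
          (cong (λ b → if b then unflipTile (tP (k ∸ suc i) j) (early (pdN (k ∸ suc i) j)) (early (pdW (k ∸ suc i) (suc j)))
                       else rotheTile i j) (lt-false (≤⇒≯ k≤i)))

        -- With these two flags all four edges prescribed for the unflipped tile are empty, as a
        -- blank needs. The elbow tiles fit for any flags.
        crossFlags : ∀ {r j} → tP r j ≡ cross → early (pdN r j) ≡ false × early (pdW r (suc j)) ≡ true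
        crossFlags x = flags (proj₂ (proj₂ (cross-labels isPD x)))
          where
          flags : ∀ {r j a b} → Cross r j a b → early (pdN r j) ≡ false × early (pdW r (suc j)) ≡ true
          flags c@(_ , (na , eb) , _) =
            trans (cong early na) (lt-false (≤⇒≯ (proj₁ (cross-late-early isPD reduced exit c)))) ,
            trans (cong early eb) (lt-true (proj₂ (cross-late-early isPD reduced exit c)))

        unflipEdges : ∀ r {j} → j < n → Edges (unflipTile (tP r j) (early (pdN r j)) (early (pdW r (suc j))))
          (early (pdN (suc r) j)) (early (pdN r j)) (not (early (pdW r (suc j)))) (not (early (pdW r j)))
        unflipEdges r {j} j<n = go (tP r j) refl
          where
          go : ∀ x → tP r j ≡ x → Edges (unflipTile (tP r j) (early (pdN r j)) (early (pdW r (suc j))))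
            (early (pdN (suc r) j)) (early (pdN r j)) (not (early (pdW r (suc j)))) (not (early (pdW r j)))
          go elbow x = subst₂ (λ N W → Edges (unflipTile (tP r j) (early (pdN r j)) (early (pdW r (suc j))))
              N (early (pdN r j)) (not (early (pdW r (suc j)))) (not W))
            (cong early (sym (pdN-elbow x))) (cong early (sym (pdW-elbow j<n x)))
            (subst (λ x → Edges (unflipTile x (early (pdN r j)) (early (pdW r (suc j))))
                (early (pdW r (suc j))) (early (pdN r j)) (not (early (pdW r (suc j)))) (not (early (pdN r j))))
              (sym x) (elbowEdges _ _))
          go cross x = subst₂ (λ N W → Edges (unflipTile (tP r j) (early (pdN r j)) (early (pdW r (suc j))))
              N (early (pdN r j)) (not (early (pdW r (suc j)))) (not W))
            (cong early (sym (pdN-cross x))) (cong early (sym (pdW-cross j<n x)))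
            (subst (λ x → Edges (unflipTile x (early (pdN r j)) (early (pdW r (suc j))))
                (early (pdN r j)) (early (pdN r j)) (not (early (pdW r (suc j)))) (not (early (pdW r (suc j)))))
              (sym x) (blankEdges (proj₁ (crossFlags x)) (proj₂ (crossFlags x))))

        earlyEdges : ∀ {i j} → i < k → j < n → let r = k ∸ suc i in
          Edges (t i j) (early (pdN (suc r) j)) (early (pdN r j)) (not (early (pdW r (suc j)))) (not (early (pdW r j)))
        earlyEdges {i} i<k j<n rewrite at-early i<k j<n = unflipEdges (k ∸ suc i) j<n

        lateEdges : ∀ {i j} → k ≤ i → i < n → j < n →
          Edges (t i j) (q j <ᵇ i) (q j <ᵇ suc i) (p i <ᵇ suc j) (p i <ᵇ j)
        lateEdges k≤i i<n j<n rewrite at-late k≤i i<n j<n = rotheEdges k≤i i<n j<n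

        open Edges

        vertical : ∀ i j → suc i < n → j < n → hasS (t i j) ≡ hasN (t (suc i) j)
        vertical i j si<n j<n with <-cmp (suc i) k
        ... | tri< si<k _ _ = trans (south≡ (earlyEdges (<-trans (n<1+n i) si<k) j<n))
          (trans (cong (λ r → early (pdN r j)) (∸-suc-suc si<k)) (sym (north≡ (earlyEdges si<k j<n))))
        -- The seam between the two constructions: row `k ∸ 1` comes from row 0 of the pipe dream,
        -- where the north edge of column `j` carries pipe `j`. It is early iff `q j < k`, which is
        -- the condition for a north edge in the Rothe row `k`.
        ... | tri≈ _ si≡k _ = trans (south≡ (earlyEdges (≤-reflexive si≡k) j<n))
          (trans (cong (λ m → early (pdN m j)) (trans (cong (_∸ suc i) (sym si≡k)) (n∸n≡0 (suc i))))
          (trans (cong (q j <ᵇ_) (sym si≡k)) (sym (north≡ (lateEdges (≤-reflexive (sym si≡k)) si<n j<n)))))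
        ... | tri> _ _ (s≤s k≤i) = trans (south≡ (lateEdges k≤i (<-trans (n<1+n i) si<n) j<n))
          (sym (north≡ (lateEdges (m≤n⇒m≤1+n k≤i) si<n j<n)))

        horizontal : ∀ i j → i < n → suc j < n → hasE (t i j) ≡ hasW (t i (suc j))
        horizontal i j i<n sj<n with i <? k
        ... | yes i<k = trans (east≡ (earlyEdges i<k (<-trans (n<1+n j) sj<n))) (sym (west≡ (earlyEdges i<k sj<n)))
        ... | no i≮k = trans (east≡ (lateEdges (≮⇒≥ i≮k) i<n (<-trans (n<1+n j) sj<n)))
          (sym (west≡ (lateEdges (≮⇒≥ i≮k) i<n sj<n)))

        northBorder : ∀ j → j < n → hasN (t 0 j) ≡ false
        northBorder j j<n with 0 <? k
        ... | yes 0<k = trans (north≡ (earlyEdges 0<k j<n))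
          (trans (cong (λ r → early (pdN r j)) (sym (∸-suc-suc 0<k))) (early-gone isPD reduced exit j<n))
        ... | no 0≮k = north≡ (lateEdges (≮⇒≥ 0≮k) (≤-<-trans z≤n j<n) j<n)

        westBorder : ∀ i → i < n → hasW (t i 0) ≡ false
        westBorder i i<n with i <? k
        ... | yes i<k = trans (west≡ (earlyEdges i<k 0<n)) (cong not (trans (cong early (exit r<n))
              (lt-true (subst (_< k) (sym (qp r<n)) (flip-< i<k)))))
          where
          0<n = ≤-<-trans z≤n i<n
          r<n = <-≤-trans (flip-< i<k) k≤n
        ... | no i≮k = west≡ (lateEdges (≮⇒≥ i≮k) i<n (≤-<-trans z≤n i<n))

        southBorder : ∀ j → j < n → hasS (t (n ∸ 1) j) ≡ true
        southBorder j j<n with n ∸ 1 <? k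
        ... | yes l<k = trans (south≡ (earlyEdges l<k j<n))
              (trans (cong (λ r → early (pdN r j)) (m≤n⇒m∸n≡0 (subst (k ≤_) n≡ k≤n)))
                     (lt-true (<-≤-trans (q<n j<n) (subst (_≤ k) (sym n≡) l<k))))
          where n≡ = ∸-suc-suc (≤-<-trans z≤n j<n)
        ... | no l≮k = trans (south≡ (lateEdges (≮⇒≥ l≮k) (subst (n ∸ 1 <_) (sym n≡) ≤-refl) j<n))
              (lt-true (subst (q j <_) n≡ (q<n j<n)))
          where n≡ = ∸-suc-suc (≤-<-trans z≤n j<n)

        eastBorder : ∀ i → i < n → hasE (t i (n ∸ 1)) ≡ true
        eastBorder i i<n with i <? k
        ... | yes i<k = trans (east≡ (earlyEdges i<k l<n))
              (cong (not ∘ early) (trans (cong (pdW (k ∸ suc i)) (sym n≡)) (pdW-east (k ∸ suc i))))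
          where
          n≡ = ∸-suc-suc (≤-<-trans z≤n i<n)
          l<n = subst (n ∸ 1 <_) (sym n≡) ≤-refl
        ... | no i≮k = trans (east≡ (lateEdges (≮⇒≥ i≮k) i<n (subst (n ∸ 1 <_) (sym n≡) ≤-refl)))
              (lt-true (subst (p i <_) n≡ (p<n i<n)))
          where n≡ = ∸-suc-suc (≤-<-trans z≤n i<n)

        unflip≢bcross : ∀ x b c → unflipTile x b c ≢ bcross
        unflip≢bcross elbow true true ()
        unflip≢bcross elbow true false ()
        unflip≢bcross elbow false true ()
        unflip≢bcross elbow false false ()

      unflip-normal : Labelled.Normal sh unflipGrid
      unflip-normal = record
        { tiling = vertical , horizontal , northBorder , westBorder , southBorder , eastBorder
        ; rothe = λ k≤i i<n j<n → lateEdges k≤i i<n j<n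
        ; uncrossed = λ i<k j<n e → unflip≢bcross _ _ _ (trans (sym (at-early i<k j<n)) e)
        }

      flip-unflipGrid : flipGrid unflipGrid ≡ P
      flip-unflipGrid = grid-ext elbow _ P same
        where
        same : ∀ {r j} → r < n → j < n → atℕ elbow (flipGrid unflipGrid) r j ≡ tP r j
        same {r} {j} r<n j<n with r <? k
        ... | yes r<k = trans (at-flip-early unflipGrid r<k j<n) (trans (cong flipTile (at-early (flip-< r<k) j<n))
          (trans (flip-unflip _ _ _) (cong (λ m → tP m j) (flip-flip r<k))))
        ... | no r≮k with tP r j in e
        ... | elbow = at-flip-late unflipGrid (≮⇒≥ r≮k) r<n j<n
        ... | cross = ⊥-elim (late-rows-uncrossed isPD reduced exit (≮⇒≥ r≮k) e)

-- Flips of normal bumpless pipe dreams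

fromEdges : Bool → Bool → Bool → Bool → BTile
fromEdges true true true true = bcross
fromEdges false false true true = horiz
fromEdges true true false false = vert
fromEdges false true true false = rT
fromEdges true false false true = jT
fromEdges _ _ _ _ = blank

fromEdges-edges : ∀ t → fromEdges (hasN t) (hasS t) (hasE t) (hasW t) ≡ t
fromEdges-edges bcross = refl
fromEdges-edges horiz = refl
fromEdges-edges vert = refl
fromEdges-edges rT = refl
fromEdges-edges jT = refl
fromEdges-edges blank = refl

edges-unique : ∀ {t t' N S E W} → Edges t N S E W → Edges t' N S E W → t ≡ t'
edges-unique {t} {t'} (edges n s e w) (edges refl refl refl refl) =
  trans (sym (fromEdges-edges t)) (trans (cong₂ (λ a b → fromEdges a b (hasE t) (hasW t)) n s)
    (trans (cong₂ (fromEdges (hasN t') (hasS t')) e w) (fromEdges-edges t')))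

-- A tile other than a cross or a blank uses exactly one of its north and east edges, and exactly
-- one of its south and west edges. Hence blankness together with the south and east edges
-- determines the tile.
uncrossed-north : ∀ {t} → t ≢ bcross → hasN t ≡ not (hasE t) ∧ not (isBlank t)
uncrossed-north {bcross} x = ⊥-elim (x refl)
uncrossed-north {horiz} _ = refl
uncrossed-north {vert} _ = refl
uncrossed-north {rT} _ = refl
uncrossed-north {jT} _ = refl
uncrossed-north {blank} _ = refl

uncrossed-west : ∀ {t} → t ≢ bcross → hasW t ≡ not (hasS t) ∧ not (isBlank t)
uncrossed-west {bcross} x = ⊥-elim (x refl)
uncrossed-west {horiz} _ = refl
uncrossed-west {vert} _ = refl
uncrossed-west {rT} _ = refl
uncrossed-west {jT} _ = refl
uncrossed-west {blank} _ = refl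

flipTile-isBlank : ∀ {t t'} → flipTile t ≡ flipTile t' → isBlank t ≡ isBlank t'
flipTile-isBlank {t} {t'} e with isBlank t | isBlank t' | e
... | true | true | _ = refl
... | false | false | _ = refl

nonblank : ∀ {t} → flipTile t ≡ elbow → isBlank t ≡ false
nonblank {t} e with isBlank t | e
... | false | _ = refl

module FlipNormal {n k : ℕ} {p q : ℕ → ℕ} (sh : Shuffle n k p q) where
  open Shuffle sh
  open Flip sh
  open Labelled using (Normal)
  open Labelled.Normal

  module _ {D : Grid BTile n} (nD : Normal sh D) where

    private
      t : ℕ → ℕ → BTile
      t = atℕ blank D

    eastmost : ∀ {i j} → i < n → j < n → ¬ suc j < n → hasE (t i j) ≡ true
    eastmost = BPDLabels.last-col D (tiling nD)

    southmost : ∀ {i j} → i < n → ¬ suc i < n → j < n → hasS (t i j) ≡ true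
    southmost = BPDLabels.last-row D (tiling nD)

  -- The flip records the blanks of the early rows. Going up from the bottom, each row receives its
  -- south edges from below; these and the blanks give all west edges at once, hence the east edges,
  -- and then the north edges.
  flip-injective : ∀ D E → Normal sh D → Normal sh E → flipGrid D ≡ flipGrid E → D ≡ E
  flip-injective D E nD nE same = grid-ext blank D E (λ i<n j<n → rows (<⇒≤ i<n) i<n j<n)
    where
    d e : ℕ → ℕ → BTile
    d = atℕ blank D
    e = atℕ blank E

    blanks : ∀ {i j} → i < k → j < n → isBlank (d i j) ≡ isBlank (e i j)
    blanks {i} {j} i<k j<n = flipTile-isBlank (subst (λ r → flipTile (d r j) ≡ flipTile (e r j)) (flip-flip i<k)
      (trans (sym (at-flip-early D (flip-< i<k) j<n))
        (trans (cong (λ P → atℕ elbow P (k ∸ suc i) j) same) (at-flip-early E (flip-< i<k) j<n))))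

    P : ℕ → Set
    P i = i < n → ∀ {j} → j < n → d i j ≡ e i j

    step : ∀ {i} → i < n → P (suc i) → P i
    step {i} i<n below _ with k ≤? i
    ... | yes k≤i = λ j<n → edges-unique (rothe nD k≤i i<n j<n) (rothe nE k≤i i<n j<n)
    ... | no k≰i = tiles
      where
      i<k = ≰⇒> k≰i
      souths : ∀ {j} → j < n → hasS (d i j) ≡ hasS (e i j)
      souths {j} j<n with suc i <? n
      ... | yes si<n = trans (proj₁ (tiling nD) i j si<n j<n)
            (trans (cong hasN (below si<n j<n)) (sym (proj₁ (tiling nE) i j si<n j<n)))
      ... | no si≮n = trans (southmost nD i<n si≮n j<n) (sym (southmost nE i<n si≮n j<n))
      wests : ∀ {j} → j < n → hasW (d i j) ≡ hasW (e i j)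
      wests j<n = trans (uncrossed-west (uncrossed nD i<k j<n))
        (trans (cong₂ (λ s b → not s ∧ not b) (souths j<n) (blanks i<k j<n)) (sym (uncrossed-west (uncrossed nE i<k j<n))))
      easts : ∀ {j} → j < n → hasE (d i j) ≡ hasE (e i j)
      easts {j} j<n with suc j <? n
      ... | yes sj<n = trans (proj₁ (proj₂ (tiling nD)) i j i<n sj<n)
            (trans (wests sj<n) (sym (proj₁ (proj₂ (tiling nE)) i j i<n sj<n)))
      ... | no sj≮n = trans (eastmost nD i<n j<n sj≮n) (sym (eastmost nE i<n j<n sj≮n))
      norths : ∀ {j} → j < n → hasN (d i j) ≡ hasN (e i j)
      norths j<n = trans (uncrossed-north (uncrossed nD i<k j<n))
        (trans (cong₂ (λ s b → not s ∧ not b) (easts j<n) (blanks i<k j<n)) (sym (uncrossed-north (uncrossed nE i<k j<n))))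
      tiles : ∀ {j} → j < n → d i j ≡ e i j
      tiles j<n = edges-unique (edges (norths j<n) (souths j<n) (easts j<n) (wests j<n)) (edges refl refl refl refl)

    rows : ∀ {i} → i ≤ n → P i
    rows = ≤⇒downward P (λ n<n → ⊥-elim (<-irrefl refl n<n)) step

  module _ {D : Grid BTile n} (nD : Normal sh D) where
    open PDLabels (flipGrid D)
    open Pipes sh (flipGrid D)

    private
      t : ℕ → ℕ → BTile
      t = atℕ blank D

      row<n : ∀ {r} → r < k → k ∸ suc r < n
      row<n r<k = <-≤-trans (flip-< r<k) k≤n

      -- Without crosses a tile with occupied east edge has no north edge. The tile above it then
      -- has no south edge, so if its own east edge is occupied it passes this on to the west. The
      -- full region thus gains one column per row upwards; after the flip it is the region where a
      -- pipe dream must have elbows.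
      full-east : ∀ r {j} → r < k → j < n → n ≤ r + j + 1 → hasE (t (k ∸ suc r) j) ≡ true
      full-east zero {j} r<k j<n n≤ =
        eastmost nD (row<n r<k) j<n (λ sj<n → <⇒≱ sj<n (subst (n ≤_) (+-comm j 1) n≤))
      full-east (suc r) {j₀} sr<k j₀<n n≤₀ =
        ≤⇒downward P (λ n<n → ⊥-elim (<-irrefl refl n<n)) step (<⇒≤ j₀<n) j₀<n n≤₀
        where
        r<k = <-trans (n<1+n r) sr<k
        i = k ∸ suc (suc r)
        P : ℕ → Set
        P j = j < n → n ≤ suc r + j + 1 → hasE (t i j) ≡ true
        step : ∀ {j} → j < n → P (suc j) → P j
        step {j} j<n IH _ n≤ with suc j <? n
        ... | no sj≮n = eastmost nD (row<n sr<k) j<n sj≮n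
        ... | yes sj<n = trans (proj₁ (proj₂ (tiling nD)) i j (row<n sr<k) sj<n)
              (full-west (uncrossed nD (flip-< sr<k) sj<n) no-south
                (IH sj<n (≤-trans n≤ (+-monoˡ-≤ 1 (+-monoʳ-≤ (suc r) (n≤1+n j))))))
          where
          i' : k ∸ suc r ≡ suc i
          i' = ∸-suc-suc sr<k
          no-north : ∀ {t} → t ≢ bcross → hasE t ≡ true → hasN t ≡ false
          no-north {t} x e = trans (uncrossed-north x) (cong (λ b → not b ∧ not (isBlank t)) e)
          full-west : ∀ {t} → t ≢ bcross → hasS t ≡ false → hasE t ≡ true → hasW t ≡ true
          full-west {bcross} x _ _ = ⊥-elim (x refl)
          full-west {horiz} _ _ _ = refl
          full-west {vert} _ () _
          full-west {rT} _ () _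
          full-west {jT} _ _ ()
          full-west {blank} _ _ ()
          no-south : hasS (t i (suc j)) ≡ false
          no-south = trans (proj₁ (tiling nD) i (suc j) (subst (_< n) i' (row<n r<k)) sj<n)
            (no-north (uncrossed nD (subst (_< k) i' (flip-< r<k)) sj<n)
              (subst (λ i → hasE (t i (suc j)) ≡ true) i'
                (full-east r r<k sj<n (subst (λ m → n ≤ m + 1) (sym (+-suc r j)) n≤))))

    flip-isPD : IsPD (flipGrid D)
    flip-isPD r j r<n j<n n≤ with k ≤? r
    ... | yes k≤r = at-flip-late D k≤r r<n j<n
    ... | no k≰r = trans (at-flip-early D (≰⇒> k≰r) j<n) (full (full-east r (≰⇒> k≰r) j<n n≤))
      where
      full : ∀ {t} → hasE t ≡ true → flipTile t ≡ elbow
      full {bcross} _ = refl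
      full {horiz} _ = refl
      full {rT} _ = refl

    private
      South West : ℕ → Set
      South r = ∀ {j} → j < n → early (pdN r j) ≡ hasS (t (k ∸ suc r) j)
      West r = ∀ {j} → j < n → early (pdW r j) ≡ not (hasW (t (k ∸ suc r) j))

      elbow-west : ∀ {t} → t ≢ bcross → isBlank t ≡ false → hasS t ≡ not (hasW t)
      elbow-west {bcross} x _ = ⊥-elim (x refl)
      elbow-west {horiz} _ _ = refl
      elbow-west {vert} _ _ = refl
      elbow-west {rT} _ _ = refl
      elbow-west {jT} _ _ = refl

      elbow-north : ∀ {t} → t ≢ bcross → isBlank t ≡ false → not (hasE t) ≡ hasN t
      elbow-north {bcross} x _ = ⊥-elim (x refl)
      elbow-north {horiz} _ _ = refl
      elbow-north {vert} _ _ = refl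
      elbow-north {rT} _ _ = refl
      elbow-north {jT} _ _ = refl

      east-of : ∀ {r j} → r < k → j < n → (suc j < n → early (pdW r (suc j)) ≡ not (hasW (t (k ∸ suc r) (suc j)))) →
        early (pdW r (suc j)) ≡ not (hasE (t (k ∸ suc r) j))
      east-of {r} {j} r<k j<n IH with suc j <? n
      ... | yes sj<n = trans (IH sj<n) (cong not (sym (proj₁ (proj₂ (tiling nD)) (k ∸ suc r) j (row<n r<k) sj<n)))
      ... | no sj≮n = trans (cong early (trans (cong (pdW r) (≤-antisym j<n (≮⇒≥ sj≮n))) (pdW-east r)))
            (cong not (sym (eastmost nD (row<n r<k) j<n sj≮n)))

      west-from-south : ∀ {r} → r < k → South r → West r
      west-from-south {r} r<k sth j<n = ≤⇒downward P (λ n<n → ⊥-elim (<-irrefl refl n<n)) step (<⇒≤ j<n) j<n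
        where
        P : ℕ → Set
        P j = j < n → early (pdW r j) ≡ not (hasW (t (k ∸ suc r) j))
        step : ∀ {j} → j < n → P (suc j) → P j
        step {j} j<n IH _ = go (tP r j) refl
          where
          go : ∀ x → tP r j ≡ x → early (pdW r j) ≡ not (hasW (t (k ∸ suc r) j))
          go cross x = trans (cong early (pdW-cross j<n x)) (trans (east-of r<k j<n IH)
            (trans (cong (not ∘ hasE) tile) (cong (not ∘ hasW) (sym tile))))
            where tile = flip-blank (trans (sym (at-flip-early D r<k j<n)) x)
          go elbow x = trans (cong early (pdW-elbow j<n x)) (trans (sth j<n)
            (elbow-west (uncrossed nD (flip-< r<k) j<n) (nonblank (trans (sym (at-flip-early D r<k j<n)) x))))

      north-from-south : ∀ {r} → r < k → South r → ∀ {j} → j < n → early (pdN (suc r) j) ≡ hasN (t (k ∸ suc r) j)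
      north-from-south {r} r<k sth {j} j<n = go (tP r j) refl
        where
        go : ∀ x → tP r j ≡ x → early (pdN (suc r) j) ≡ hasN (t (k ∸ suc r) j)
        go cross x = trans (cong early (pdN-cross x)) (trans (sth j<n)
          (trans (cong hasS tile) (cong hasN (sym tile))))
          where tile = flip-blank (trans (sym (at-flip-early D r<k j<n)) x)
        go elbow x = trans (cong early (pdN-elbow x))
          (trans (east-of r<k j<n (west-from-south r<k sth))
            (elbow-north (uncrossed nD (flip-< r<k) j<n) (nonblank (trans (sym (at-flip-early D r<k j<n)) x))))

      -- For `r ≡ 0` the pipe dream side is the north border, where pipe `j` is early iff `q j < k`;
      -- the bumpless side is the north of the Rothe row `k`, or the south border when `k ≡ n`.
      south-edges : ∀ r → r < k → South r
      south-edges zero 0<k {j} j<n with k <? n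
      ... | yes k<n = sym (trans (proj₁ (tiling nD) (k ∸ 1) j (subst (_< n) k≡ k<n) j<n)
            (trans (cong (λ i → hasN (t i j)) (sym k≡)) (Edges.north≡ (rothe nD ≤-refl k<n j<n))))
        where k≡ = ∸-suc-suc 0<k
      ... | no k≮n = trans (lt-true (<-≤-trans (q<n j<n) (≮⇒≥ k≮n)))
            (sym (southmost nD (row<n 0<k) (λ l → k≮n (subst (_< n) (sym (∸-suc-suc 0<k)) l)) j<n))
      south-edges (suc r) sr<k {j} j<n = trans (north-from-south r<k (south-edges r r<k) j<n)
        (trans (cong (λ i → hasN (t i j)) (∸-suc-suc sr<k))
          (sym (proj₁ (tiling nD) (k ∸ suc (suc r)) j (subst (_< n) (∸-suc-suc sr<k) (row<n r<k)) j<n)))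
        where r<k = <-trans (n<1+n r) sr<k

      -- The variable `m` allows a case split on `k`: for `k ≡ 0` no pipe is early, and otherwise
      -- the edges in question match the empty north border of `D`.
      early-gone-k : ∀ m → m ≡ k → ∀ {j} → j < n → early (pdN m j) ≡ false
      early-gone-k zero 0≡k j<n = lt-false (λ l → case subst (_ <_) (sym 0≡k) l of λ ())
      early-gone-k (suc r) sr≡k {j} j<n = trans (north-from-south r<k (south-edges r r<k) j<n)
        (trans (cong (λ i → hasN (t i j)) (trans (cong (_∸ suc r) (sym sr≡k)) (n∸n≡0 (suc r))))
          (proj₁ (proj₂ (proj₂ (tiling nD))) j j<n))
        where r<k = ≤-reflexive sr≡k

      -- Late rows consist of elbows, so each of them merely shifts the labels one column to the
      -- left and no early pipe reappears.
      late-north : ∀ d {j} → k + d ≤ n → j < n → early (pdN (k + d) j) ≡ false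
      late-north zero _ j<n = early-gone-k (k + 0) (+-identityʳ k) j<n
      late-north (suc d) {j} le j<n = trans (cong (λ m → early (pdN m j)) (+-suc k d))
        (trans (cong early (pdN-elbow (at-flip-late D (m≤m+n k d) lt j<n))) late-west)
        where
        lt : k + d < n
        lt = subst (_≤ n) (+-suc k d) le
        late-west : early (pdW (k + d) (suc j)) ≡ false
        late-west with suc j <? n
        ... | yes sj<n = trans (cong early (pdW-elbow sj<n (at-flip-late D (m≤m+n k d) lt sj<n)))
              (late-north d (<⇒≤ lt) sj<n)
        ... | no sj≮n = cong early (trans (cong (pdW (k + d)) (≤-antisym j<n (≮⇒≥ sj≮n))) (pdW-east (k + d)))

      late-exit : ∀ {i} → k ≤ i → i < n → early (pdW i 0) ≡ false
      late-exit {i} k≤i i<n = trans (cong early (pdW-elbow 0<n (at-flip-late D k≤i i<n 0<n)))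
        (subst (λ m → early (pdN m 0) ≡ false) (m+[n∸m]≡n k≤i)
          (late-north (i ∸ k) (subst (_≤ n) (sym (m+[n∸m]≡n k≤i)) (<⇒≤ i<n)) 0<n))
        where 0<n = ≤-<-trans z≤n i<n

      early-exit : ∀ {i} → i < k → early (pdW i 0) ≡ true
      early-exit {i} i<k = trans (west-from-south i<k (south-edges i i<k) (≤-<-trans z≤n (<-≤-trans i<k k≤n)))
        (cong not (proj₁ (proj₂ (proj₂ (proj₂ (tiling nD)))) (k ∸ suc i) (row<n i<k)))

      -- A cross is a flipped blank: its empty south edge makes the pipe from the north late, and
      -- its empty east edge makes the pipe from the east early.
      cross-classes : ∀ {r j a b} → Cross r j a b → k ≤ q a × q b < k
      cross-classes {r} {j} (x , (na , eb) , _) with r<n , j<n , _ ← cross-in-triangle flip-isPD x with k ≤? r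
      ... | yes k≤r = case trans (sym x) (at-flip-late D k≤r r<n j<n) of λ ()
      ... | no k≰r = ≮⇒≥ (false-lt (trans (sym (cong early na)) (trans (south-edges r r<k j<n) (cong hasS tile)))) ,
            true-lt (trans (sym (cong early eb))
              (trans (east-of r<k j<n (west-from-south r<k (south-edges r r<k))) (cong (not ∘ hasE) tile)))
        where
        r<k = ≰⇒> k≰r
        tile = flip-blank (trans (sym (at-flip-early D r<k j<n)) x)

      label : ℕ → ℕ
      label i = fromMaybe 0 (pdW i 0)

      label≡ : ∀ {i} → i < n → pdW i 0 ≡ just (label i)
      label≡ {i} i<n = from (justW flip-isPD i 0 (n ∸ suc (i + 0)) (m+[n∸m]≡n (subst (_< n) (sym (+-identityʳ i)) i<n)))
        where
        from : ∀ {x : Maybe ℕ} → is-just x ≡ true → x ≡ just (fromMaybe 0 x)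
        from {just _} _ = refl

      label<n : ∀ {i} → i < n → label i < n
      label<n {i} i<n = belowW i z≤n (label≡ i<n)

      label-early : ∀ {i} → i < k → q (label i) < k
      label-early i<k = true-lt (trans (sym (cong early (label≡ (<-≤-trans i<k k≤n)))) (early-exit i<k))

      label-late : ∀ {i} → k ≤ i → i < n → k ≤ q (label i)
      label-late k≤i i<n = ≮⇒≥ (false-lt (trans (sym (cong early (label≡ i<n))) (late-exit k≤i i<n)))

      -- Two pipes of the same class never cross, so their order of exit along the west border is
      -- their order along the north border.
      label-increasing : ∀ {i i'} → i < i' → i' < n → i' < k ⊎ k ≤ i → label i < label i'
      label-increasing {i} {i'} i<i' i'<n same =
        top-sorted (ascend ≤-refl (λ z → z) ≤-refl (λ _ _ _ → free same)
          (i , i' , i<i' , west i<n (label≡ i<n) , west i'<n (label≡ i'<n)))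
        where
        i<n = <-trans i<i' i'<n
        free : i' < k ⊎ k ≤ i → ∀ {r l} → ¬ Cross r l (label i') (label i)
        free (inj₁ i'<k) c = <⇒≱ (label-early i'<k) (proj₁ (cross-classes c))
        free (inj₂ k≤i) c = <⇒≱ (proj₂ (cross-classes c)) (label-late k≤i i<n)

      from-q-label : ∀ {i} → i < n → q (label i) ≡ i → pdW i 0 ≡ just (p i)
      from-q-label i<n e = trans (label≡ i<n) (cong just (trans (sym (pq (label<n i<n))) (cong p e)))

    flip-exits : ExitsInOrder
    flip-exits {i} i<n with k ≤? i
    ... | yes k≤i = from-q-label i<n (increasing-self-map {λ i → q (label i)} {k} {n}
            (λ k≤i i<n → label-late k≤i i<n , q<n (label<n i<n))
            (λ k≤i i<i' i'<n → q-increasing (label<n (<-trans i<i' i'<n)) (label<n i'<n)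
              (label-increasing i<i' i'<n (inj₂ k≤i)) (inj₂ (label-late (≤-trans k≤i (<⇒≤ i<i')) i'<n)))
            k≤i i<n)
    ... | no k≰i = from-q-label i<n (increasing-self-map {λ i → q (label i)} {0} {k}
            (λ _ i<k → z≤n , label-early i<k)
            (λ _ i<i' i'<k → let i'<n = <-≤-trans i'<k k≤n in
              q-increasing (label<n (<-trans i<i' i'<n)) (label<n i'<n)
              (label-increasing i<i' i'<n (inj₁ i'<k)) (inj₁ (label-early (<-trans i<i' i'<k))))
            z≤n (≰⇒> k≰i))

    -- At every cross the pipe from the north is late and the one from the east early, so no pair
    -- crosses in both orientations and `oriented⇒unique` applies.
    flip-reduced : PDReduced (flipGrid D)
    flip-reduced i j i' j' x x' same = unique (cross-labels flip-isPD x) (cross-labels flip-isPD x')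
      where
      oriented : ∀ {i j i' j' a b} → Cross i j a b → ¬ Cross i' j' b a
      oriented c c' = <⇒≱ (proj₂ (cross-classes c)) (proj₁ (cross-classes c'))
      distinct : ∀ {a} → ¬ Ord 0 n a a
      distinct o = <-irrefl refl (top-sorted o)
      strip : ∀ {a b a' b'} → pdN i j ≡ just a → pdE i j ≡ just b → pdN i' j' ≡ just a' → pdE i' j' ≡ just b' →
        SamePair (pdN i j) (pdE i j) (pdN i' j') (pdE i' j') → SamePair a b a' b'
      strip na eb na' eb' (inj₁ (m , e)) = inj₁ (just-injective (trans (sym na) (trans m na')) ,
        just-injective (trans (sym eb) (trans e eb')))
      strip na eb na' eb' (inj₂ (m , e)) = inj₂ (just-injective (trans (sym na) (trans m eb')) ,
        just-injective (trans (sym eb) (trans e na')))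
      unique : ∃₂ (Cross i j) → ∃₂ (Cross i' j') → i ≡ i' × j ≡ j'
      unique (a , b , c@(_ , (na , eb) , _)) (a' , b' , c'@(_ , (na' , eb') , _))
        with i<n , j<n , _ ← cross-in-triangle flip-isPD x | i'<n , j'<n , _ ← cross-in-triangle flip-isPD x' =
        oriented⇒unique oriented distinct i<n j<n i'<n j'<n c c' (strip na eb na' eb' same)

-- Droops and slides

data Position (i j : ℕ) : ℕ → ℕ → Set where
  nw : Position i j i j
  ne : Position i j i (suc j)
  sw : Position i j (suc i) j
  se : Position i j (suc i) (suc j)
  outside : ∀ {a l} → OutsideBlock i j a l → Position i j a l

position : ∀ i j a l → Position i j a l
position i j a l with l ≟ j | l ≟ suc j | a ≟ i | a ≟ suc i
... | no l≢j | no l≢sj | _ | _ = outside (inj₂ (l≢j , l≢sj))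
... | _ | _ | no a≢i | no a≢si = outside (inj₁ (a≢i , a≢si))
... | yes refl | _ | yes refl | _ = nw
... | no _ | yes refl | yes refl | _ = ne
... | yes refl | _ | no _ | yes refl = sw
... | no _ | yes refl | no _ | yes refl = se

module _ {A : Set} (i j : ℕ) (w x y z : A) (f : ℕ → ℕ → A) where

  block : ℕ → ℕ → A
  block a l with position i j a l
  ... | nw = w
  ... | ne = x
  ... | sw = y
  ... | se = z
  ... | outside _ = f a l

  block-nw : block i j ≡ w
  block-nw with j ≟ j | j ≟ suc j | i ≟ i | i ≟ suc i
  ... | yes refl | _ | yes refl | _ = refl
  ... | no ne' | _ | _ | _ = ⊥-elim (ne' refl)
  ... | yes _ | _ | no ne' | _ = ⊥-elim (ne' refl)

  block-ne : block i (suc j) ≡ x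
  block-ne with suc j ≟ j | suc j ≟ suc j | i ≟ i | i ≟ suc i
  ... | no _ | yes refl | yes refl | _ = refl
  ... | yes e | _ | _ | _ = ⊥-elim (1+n≢n e)
  ... | _ | no ne' | _ | _ = ⊥-elim (ne' refl)
  ... | no _ | yes _ | no ne' | _ = ⊥-elim (ne' refl)

  block-sw : block (suc i) j ≡ y
  block-sw with j ≟ j | j ≟ suc j | suc i ≟ i | suc i ≟ suc i
  ... | yes refl | _ | no _ | yes refl = refl
  ... | no ne' | _ | _ | _ = ⊥-elim (ne' refl)
  ... | _ | _ | yes e | _ = ⊥-elim (1+n≢n e)
  ... | yes _ | _ | no _ | no ne' = ⊥-elim (ne' refl)

  block-se : block (suc i) (suc j) ≡ z
  block-se with suc j ≟ j | suc j ≟ suc j | suc i ≟ i | suc i ≟ suc i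
  ... | no _ | yes refl | no _ | yes refl = refl
  ... | yes e | _ | _ | _ = ⊥-elim (1+n≢n e)
  ... | _ | no ne' | _ | _ = ⊥-elim (ne' refl)
  ... | _ | _ | yes e | _ = ⊥-elim (1+n≢n e)
  ... | no _ | yes _ | no _ | no ne' = ⊥-elim (ne' refl)

  inside-outside : ∀ {a l} → OutsideBlock i j a l → a ≡ i ⊎ a ≡ suc i → l ≡ j ⊎ l ≡ suc j → ⊥
  inside-outside (inj₁ (a≢i , _)) (inj₁ e) _ = a≢i e
  inside-outside (inj₁ (_ , a≢si)) (inj₂ e) _ = a≢si e
  inside-outside (inj₂ (l≢j , _)) _ (inj₁ e) = l≢j e
  inside-outside (inj₂ (_ , l≢sj)) _ (inj₂ e) = l≢sj e

  block-outside : ∀ {a l} → OutsideBlock i j a l → block a l ≡ f a l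
  block-outside {a} {l} o with position i j a l
  ... | nw = ⊥-elim (inside-outside o (inj₁ refl) (inj₁ refl))
  ... | ne = ⊥-elim (inside-outside o (inj₁ refl) (inj₂ refl))
  ... | sw = ⊥-elim (inside-outside o (inj₂ refl) (inj₁ refl))
  ... | se = ⊥-elim (inside-outside o (inj₂ refl) (inj₂ refl))
  ... | outside _ = refl

ne-elbows : ∀ {t t'} → (t ≡ horiz × t' ≡ rT) ⊎ (t ≡ jT × t' ≡ vert) →
  flipTile t ≡ elbow × flipTile t' ≡ elbow
ne-elbows (inj₁ (refl , refl)) = refl , refl
ne-elbows (inj₂ (refl , refl)) = refl , refl

sw-elbows : ∀ {t t'} → (t ≡ vert × t' ≡ rT) ⊎ (t ≡ jT × t' ≡ horiz) →
  flipTile t ≡ elbow × flipTile t' ≡ elbow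
sw-elbows (inj₁ (refl , refl)) = refl , refl
sw-elbows (inj₂ (refl , refl)) = refl , refl

ne-edges : ∀ {t t'} → (t ≡ horiz × t' ≡ rT) ⊎ (t ≡ jT × t' ≡ vert) →
  hasN t ≡ hasN t' × hasE t ≡ hasE t' × hasS t ≡ false × hasW t ≡ true
ne-edges (inj₁ (refl , refl)) = refl , refl , refl , refl
ne-edges (inj₂ (refl , refl)) = refl , refl , refl , refl

sw-edges : ∀ {t t'} → (t ≡ vert × t' ≡ rT) ⊎ (t ≡ jT × t' ≡ horiz) →
  hasS t ≡ hasS t' × hasW t ≡ hasW t' × hasN t ≡ true × hasE t ≡ false
sw-edges (inj₁ (refl , refl)) = refl , refl , refl , refl
sw-edges (inj₂ (refl , refl)) = refl , refl , refl , refl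

module Steps {n k : ℕ} {p q : ℕ → ℕ} (sh : Shuffle n k p q) where
  open Shuffle sh
  open Flip sh
  open FlipNormal sh
  open Labelled using (Normal)
  open Labelled.Normal

  -- The invariant carried along a chain of droops. A droop needs a blank at its lower right corner,
  -- so its whole block lies in the rows that are flipped.
  EarlyBlanks : Grid BTile n → Set
  EarlyBlanks D = ∀ {i j} → i < n → j < n → atℕ blank D i j ≡ blank → i < k

  -- In a late row an empty south edge means `i < q j`, hence `p i < j`, and then the west edge is
  -- occupied.
  normal⇒earlyBlanks : ∀ D → Normal sh D → EarlyBlanks D
  normal⇒earlyBlanks D nD {i} {j} i<n j<n b with k ≤? i
  ... | no k≰i = ≰⇒> k≰i
  ... | yes k≤i with rothe nD k≤i i<n j<n
  ... | edges _ s _ w = ⊥-elim (false-lt (trans (sym w) (cong hasW b))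
        (right-of-bound k≤i i<n j<n (≰⇒> (λ qj≤i → false-lt {q j} (trans (sym s) (cong hasS b)) (s≤s qj≤i)))))

  at-flip : ∀ D {r i j} → r < k → k ∸ suc r ≡ i → j < n → atℕ elbow (flipGrid D) r j ≡ flipTile (atℕ blank D i j)
  at-flip D r<k refl j<n = at-flip-early D r<k j<n

  -- With r = k ∸ suc (suc i), rows r and r + 1 of the pipe dream are rows i + 1 and i of the
  -- bumpless pipe dream.
  flip-outside : ∀ {i j a l} → suc i < k → a < k →
    OutsideBlock (k ∸ suc (suc i)) j a l → OutsideBlock i j (k ∸ suc a) l
  flip-outside si<k a<k (inj₂ o) = inj₂ o
  flip-outside si<k a<k (inj₁ (a≢ , a≢')) = inj₁
    ( (λ e → a≢' (trans (sym (flip-flip a<k)) (trans (cong (λ m → k ∸ suc m) e) (∸-suc-suc si<k))))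
    , (λ e → a≢ (trans (sym (flip-flip a<k)) (cong (λ m → k ∸ suc m) e))))

  droop⇒slide : ∀ D D' → EarlyBlanks D → DroopStep D D' →
    EarlyBlanks D' × SlideStep (flipGrid D') (flipGrid D)
  droop⇒slide D D' eD (i , j , si<n , sj<n , nw-r , se-b , nw-b , se-j , sw-c , ne-c , out) =
    early ,
    r , j , <-≤-trans sr<k k≤n , sj<n ,
    trans (at-flip D' sr<k lower j<n) (cong flipTile nw-b) ,
    trans (at-flip D' sr<k lower sj<n) (proj₂ (ne-elbows ne-c)) ,
    trans (at-flip D' r<k upper j<n) (proj₂ (sw-elbows sw-c)) ,
    trans (at-flip D' r<k upper sj<n) (cong flipTile se-j) ,
    trans (at-flip D sr<k lower j<n) (cong flipTile nw-r) ,
    trans (at-flip D r<k upper sj<n) (cong flipTile se-b) ,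
    trans (at-flip D sr<k lower sj<n) (proj₁ (ne-elbows ne-c)) ,
    trans (at-flip D r<k upper j<n) (proj₁ (sw-elbows sw-c)) ,
    rest
    where
    r = k ∸ suc (suc i)
    j<n = <-trans (n<1+n j) sj<n
    si<k : suc i < k
    si<k = eD si<n sj<n se-b
    i<k = <-trans (n<1+n i) si<k
    r<k : r < k
    r<k = flip-< si<k
    sr<k : suc r < k
    sr<k = subst (_< k) (∸-suc-suc si<k) (flip-< i<k)
    upper : k ∸ suc r ≡ suc i
    upper = flip-flip si<k
    lower : k ∸ suc (suc r) ≡ i
    lower = trans (cong (λ m → k ∸ suc m) (sym (∸-suc-suc si<k))) (flip-flip i<k)
    early : EarlyBlanks D'
    early {a} {l} a<n l<n b with position i j a l
    ... | nw = i<k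
    ... | ne = i<k
    ... | sw = si<k
    ... | se = si<k
    ... | outside o = eD a<n l<n (trans (sym (out a l a<n l<n o)) b)
    rest : ∀ a l → a < n → l < n → OutsideBlock r j a l →
      atℕ elbow (flipGrid D) a l ≡ atℕ elbow (flipGrid D') a l
    rest a l a<n l<n o with a <? k
    ... | yes a<k = trans (at-flip-early D a<k l<n) (trans
          (cong flipTile (sym (out (k ∸ suc a) l (<-≤-trans (flip-< a<k) k≤n) l<n (flip-outside si<k a<k o))))
          (sym (at-flip-early D' a<k l<n)))
    ... | no a≮k = trans (at-flip-late D (≮⇒≥ a≮k) a<n l<n) (sym (at-flip-late D' (≮⇒≥ a≮k) a<n l<n))

  droops⇒slides : ∀ D E → EarlyBlanks D → D ≤droop E → flipGrid E ≤slide flipGrid D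
  droops⇒slides D .D _ ε = ε
  droops⇒slides D E eD (_◅_ {j = D'} step steps) =
    droops⇒slides D' E (proj₁ (droop⇒slide D D' eD step)) steps ◅◅ (proj₂ (droop⇒slide D D' eD step) ◅ ε)

  -- A droop keeps the occupancy of all edges on the boundary of its block, so the tiling conditions
  -- need a new check only on the four edges inside. The bound on the row keeps the late rows
  -- untouched.
  undroop-normal : ∀ D E → Normal sh E → (step : DroopStep D E) → suc (proj₁ step) < k → Normal sh D
  undroop-normal D E nE (i , j , si<n , sj<n , nw-t , se-t , nw-t' , se-t' , sw-c , ne-c , out) si<k = record
    { tiling = vertical , horizontal ,
        (λ l l<n → trans (sameN (≤-<-trans z≤n l<n) l<n λ ()) (northBorder l l<n)) ,
        (λ a a<n → trans (sameW a<n (≤-<-trans z≤n a<n) λ ()) (westBorder a a<n)) ,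
        (λ l l<n → trans (sameS (last<n l<n) l<n (λ e → <⇒≢ si<n (sym (trans (n≡ l<n) (cong suc e))))) (southBorder l l<n)) ,
        (λ a a<n → trans (sameE a<n (last<n a<n) (λ e → <⇒≢ sj<n (sym (trans (n≡ a<n) (cong suc e))))) (eastBorder a a<n))
    ; rothe = λ {a} k≤a a<n {l} l<n → subst (λ x → Edges x (q l <ᵇ a) (q l <ᵇ suc a) (p a <ᵇ suc l) (p a <ᵇ l))
        (out a l a<n l<n (inj₁ (>⇒≢ (<-≤-trans (<-trans (n<1+n i) si<k) k≤a) , >⇒≢ (<-≤-trans si<k k≤a))))
        (rothe nE k≤a a<n l<n)
    ; uncrossed = uncrossed-above
    }
    where
    t t' : ℕ → ℕ → BTile
    t = atℕ blank D
    t' = atℕ blank E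
    vert' = proj₁ (tiling nE)
    horiz' = proj₁ (proj₂ (tiling nE))
    northBorder = proj₁ (proj₂ (proj₂ (tiling nE)))
    westBorder = proj₁ (proj₂ (proj₂ (proj₂ (tiling nE))))
    southBorder = proj₁ (proj₂ (proj₂ (proj₂ (proj₂ (tiling nE)))))
    eastBorder = proj₂ (proj₂ (proj₂ (proj₂ (proj₂ (tiling nE)))))

    n≡ : ∀ {a} → a < n → n ≡ suc (n ∸ 1)
    n≡ a<n = ∸-suc-suc (≤-<-trans z≤n a<n)

    last<n : ∀ {a} → a < n → n ∸ 1 < n
    last<n a<n = subst (n ∸ 1 <_) (sym (n≡ a<n)) ≤-refl

    ne-N = proj₁ (ne-edges ne-c)
    ne-E = proj₁ (proj₂ (ne-edges ne-c))
    ne-S = proj₁ (proj₂ (proj₂ (ne-edges ne-c)))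
    ne-W = proj₂ (proj₂ (proj₂ (ne-edges ne-c)))
    sw-S = proj₁ (sw-edges sw-c)
    sw-W = proj₁ (proj₂ (sw-edges sw-c))
    sw-N = proj₁ (proj₂ (proj₂ (sw-edges sw-c)))
    sw-E = proj₂ (proj₂ (proj₂ (sw-edges sw-c)))

    sameN : ∀ {a l} → a < n → l < n → a ≢ suc i → hasN (t a l) ≡ hasN (t' a l)
    sameN {a} {l} a<n l<n a≢ with position i j a l
    ... | nw = trans (cong hasN nw-t) (cong hasN (sym nw-t'))
    ... | ne = ne-N
    ... | sw = ⊥-elim (a≢ refl)
    ... | se = ⊥-elim (a≢ refl)
    ... | outside o = cong hasN (sym (out a l a<n l<n o))

    sameS : ∀ {a l} → a < n → l < n → a ≢ i → hasS (t a l) ≡ hasS (t' a l)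
    sameS {a} {l} a<n l<n a≢ with position i j a l
    ... | nw = ⊥-elim (a≢ refl)
    ... | ne = ⊥-elim (a≢ refl)
    ... | sw = sw-S
    ... | se = trans (cong hasS se-t) (cong hasS (sym se-t'))
    ... | outside o = cong hasS (sym (out a l a<n l<n o))

    sameW : ∀ {a l} → a < n → l < n → l ≢ suc j → hasW (t a l) ≡ hasW (t' a l)
    sameW {a} {l} a<n l<n l≢ with position i j a l
    ... | nw = trans (cong hasW nw-t) (cong hasW (sym nw-t'))
    ... | ne = ⊥-elim (l≢ refl)
    ... | sw = sw-W
    ... | se = ⊥-elim (l≢ refl)
    ... | outside o = cong hasW (sym (out a l a<n l<n o))

    sameE : ∀ {a l} → a < n → l < n → l ≢ j → hasE (t a l) ≡ hasE (t' a l)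
    sameE {a} {l} a<n l<n l≢ with position i j a l
    ... | nw = ⊥-elim (l≢ refl)
    ... | ne = ne-E
    ... | sw = ⊥-elim (l≢ refl)
    ... | se = trans (cong hasE se-t) (cong hasE (sym se-t'))
    ... | outside o = cong hasE (sym (out a l a<n l<n o))

    vertical : ∀ a l → suc a < n → l < n → hasS (t a l) ≡ hasN (t (suc a) l)
    vertical a l sa<n l<n with a ≟ i
    ... | no a≢i = trans (sameS (<-trans (n<1+n a) sa<n) l<n a≢i) (trans (vert' a l sa<n l<n)
          (sym (sameN sa<n l<n (λ e → a≢i (suc-injective e)))))
    ... | yes refl with l ≟ j | l ≟ suc j
    ... | yes refl | _ = trans (cong hasS nw-t) (sym sw-N)
    ... | no _ | yes refl = trans ne-S (sym (cong hasN se-t))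
    ... | no l≢j | no l≢sj = trans (cong hasS (sym (out a l (<-trans (n<1+n a) sa<n) l<n (inj₂ (l≢j , l≢sj)))))
          (trans (vert' a l sa<n l<n) (cong hasN (out (suc a) l sa<n l<n (inj₂ (l≢j , l≢sj)))))

    horizontal : ∀ a l → a < n → suc l < n → hasE (t a l) ≡ hasW (t a (suc l))
    horizontal a l a<n sl<n with l ≟ j
    ... | no l≢j = trans (sameE a<n (<-trans (n<1+n l) sl<n) l≢j) (trans (horiz' a l a<n sl<n)
          (sym (sameW a<n sl<n (λ e → l≢j (suc-injective e)))))
    ... | yes refl with a ≟ i | a ≟ suc i
    ... | yes refl | _ = trans (cong hasE nw-t) (sym ne-W)
    ... | no _ | yes refl = trans sw-E (sym (cong hasW se-t))
    ... | no a≢i | no a≢si = trans (cong hasE (sym (out a l a<n (<-trans (n<1+n l) sl<n) (inj₁ (a≢i , a≢si)))))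
          (trans (horiz' a l a<n sl<n) (cong hasW (out a (suc l) a<n sl<n (inj₁ (a≢i , a≢si)))))

    uncrossed-above : ∀ {a l} → a < k → l < n → t a l ≢ bcross
    uncrossed-above {a} {l} a<k l<n e with position i j a l
    ... | nw = case trans (sym e) nw-t of λ ()
    ... | ne = false≢true ne-S (cong hasS e)
    ... | sw = false≢true sw-E (cong hasE e)
    ... | se = case trans (sym e) se-t of λ ()
    ... | outside o = uncrossed nE a<k l<n (trans (out a l (<-≤-trans a<k k≤n) l<n o) e)

  -- The cross that slides is a blank of `E` at `(i , j)`. Its empty edges and the elbows required
  -- by the slide leave only `rT` or `vert` to its right and `rT` or `horiz` below it; these occupy
  -- the north and west edges of the diagonal neighbour, which must be `jT`. This is the result of a
  -- droop, and the two alternatives tell which tiles to restore.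
  slide⇒undroop : ∀ E Q → Normal sh E → SlideStep (flipGrid E) Q →
    ∃ λ D → Normal sh D × DroopStep D E × flipGrid D ≡ Q
  slide⇒undroop E Q nE (r , j , sr<n , sj<n , sw-x , se-o , nw-o , ne-o , sw-o' , ne-x' , se-o' , nw-o' , out) =
    D , undroop-normal D E nE droop si<k , droop , grid-ext elbow (flipGrid D) Q flips
    where
    P = flipGrid E
    j<n = <-trans (n<1+n j) sj<n
    sr<k : suc r < k
    sr<k = ≰⇒> (λ k≤sr → case trans (sym sw-x) (at-flip-late E k≤sr sr<n j<n) of λ ())
    r<k = <-trans (n<1+n r) sr<k
    i = k ∸ suc (suc r)
    i<k : i < k
    i<k = flip-< sr<k
    upper : k ∸ suc r ≡ suc i
    upper = ∸-suc-suc sr<k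
    si<k : suc i < k
    si<k = subst (_< k) upper (flip-< r<k)
    si<n = <-≤-trans si<k k≤n
    i<n = <-≤-trans i<k k≤n
    a b x y : BTile
    a = atℕ blank E i j
    b = atℕ blank E i (suc j)
    x = atℕ blank E (suc i) j
    y = atℕ blank E (suc i) (suc j)
    a≡ : a ≡ blank
    a≡ = flip-blank (trans (sym (at-flip E sr<k refl j<n)) sw-x)

    b-cases : ∀ {b} → b ≢ bcross → isBlank b ≡ false → hasW b ≡ false → (rT ≡ b ⊎ vert ≡ b) × hasS b ≡ true
    b-cases {bcross} c _ _ = ⊥-elim (c refl)
    b-cases {vert} _ _ _ = inj₂ refl , refl
    b-cases {rT} _ _ _ = inj₁ refl , refl
    x-cases : ∀ {x} → x ≢ bcross → isBlank x ≡ false → hasN x ≡ false → (rT ≡ x ⊎ horiz ≡ x) × hasE x ≡ true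
    x-cases {bcross} c _ _ = ⊥-elim (c refl)
    x-cases {horiz} _ _ _ = inj₂ refl , refl
    x-cases {rT} _ _ _ = inj₁ refl , refl
    y-cases : ∀ {y} → y ≢ bcross → hasN y ≡ true → hasW y ≡ true → y ≡ jT
    y-cases {bcross} c _ _ = ⊥-elim (c refl)
    y-cases {jT} _ _ _ = refl

    bc = b-cases (uncrossed nE i<k sj<n) (nonblank (trans (sym (at-flip E sr<k refl sj<n)) se-o))
      (trans (sym (proj₁ (proj₂ (tiling nE)) i j i<n sj<n)) (cong hasE a≡))
    xc = x-cases (uncrossed nE si<k j<n) (nonblank (trans (sym (at-flip E r<k upper j<n)) nw-o))
      (trans (sym (proj₁ (tiling nE) i j si<n j<n)) (cong hasS a≡))
    y≡ : y ≡ jT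
    y≡ = y-cases (uncrossed nE si<k sj<n) (trans (sym (proj₁ (tiling nE) i (suc j) si<n sj<n)) (proj₂ bc))
      (trans (sym (proj₁ (proj₂ (tiling nE)) (suc i) j si<n sj<n)) (proj₂ xc))

    b₀ : ∀ {b} → rT ≡ b ⊎ vert ≡ b → ∃ λ b₀ → (b₀ ≡ horiz × b ≡ rT) ⊎ (b₀ ≡ jT × b ≡ vert)
    b₀ (inj₁ refl) = horiz , inj₁ (refl , refl)
    b₀ (inj₂ refl) = jT , inj₂ (refl , refl)
    x₀ : ∀ {x} → rT ≡ x ⊎ horiz ≡ x → ∃ λ x₀ → (x₀ ≡ vert × x ≡ rT) ⊎ (x₀ ≡ jT × x ≡ horiz)
    x₀ (inj₁ refl) = vert , inj₁ (refl , refl)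
    x₀ (inj₂ refl) = jT , inj₂ (refl , refl)
    newB = b₀ (proj₁ bc)
    newX = x₀ (proj₁ xc)

    tiles : ℕ → ℕ → BTile
    tiles = block i j rT (proj₁ newB) (proj₁ newX) blank (atℕ blank E)
    D : Grid BTile n
    D = gridFrom tiles

    nw≡ : atℕ blank D i j ≡ rT
    nw≡ = trans (at-gridFrom blank tiles i<n j<n) (block-nw i j rT (proj₁ newB) (proj₁ newX) blank (atℕ blank E))
    ne≡ : atℕ blank D i (suc j) ≡ proj₁ newB
    ne≡ = trans (at-gridFrom blank tiles i<n sj<n) (block-ne i j rT (proj₁ newB) (proj₁ newX) blank (atℕ blank E))
    sw≡ : atℕ blank D (suc i) j ≡ proj₁ newX
    sw≡ = trans (at-gridFrom blank tiles si<n j<n) (block-sw i j rT (proj₁ newB) (proj₁ newX) blank (atℕ blank E))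
    se≡ : atℕ blank D (suc i) (suc j) ≡ blank
    se≡ = trans (at-gridFrom blank tiles si<n sj<n) (block-se i j rT (proj₁ newB) (proj₁ newX) blank (atℕ blank E))
    outD : ∀ a l → a < n → l < n → OutsideBlock i j a l → atℕ blank E a l ≡ atℕ blank D a l
    outD a l a<n l<n o = sym (trans (at-gridFrom blank tiles a<n l<n)
      (block-outside i j rT (proj₁ newB) (proj₁ newX) blank (atℕ blank E) o))

    droop : DroopStep D E
    droop = i , j , si<n , sj<n , nw≡ , se≡ , a≡ , y≡ ,
      subst (λ t → (t ≡ vert × x ≡ rT) ⊎ (t ≡ jT × x ≡ horiz)) (sym sw≡) (proj₂ newX) ,
      subst (λ t → (t ≡ horiz × b ≡ rT) ⊎ (t ≡ jT × b ≡ vert)) (sym ne≡) (proj₂ newB) ,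
      outD

    flips : ∀ {a l} → a < n → l < n → atℕ elbow (flipGrid D) a l ≡ atℕ elbow Q a l
    flips {a} {l} a<n l<n with a <? k
    ... | no a≮k = trans (at-flip-late D (≮⇒≥ a≮k) a<n l<n) (sym (trans
          (out a l a<n l<n (inj₁ ((λ e → a≮k (subst (_< k) (sym e) r<k)) , (λ e → a≮k (subst (_< k) (sym e) sr<k)))))
          (at-flip-late E (≮⇒≥ a≮k) a<n l<n)))
    ... | yes a<k with position r j a l
    ... | nw = trans (at-flip D r<k upper j<n) (trans (cong flipTile sw≡) (trans (proj₁ (sw-elbows (proj₂ newX))) (sym nw-o')))
    ... | ne = trans (at-flip D r<k upper sj<n) (trans (cong flipTile se≡) (sym ne-x'))
    ... | sw = trans (at-flip D sr<k refl j<n) (trans (cong flipTile nw≡) (sym sw-o'))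
    ... | se = trans (at-flip D sr<k refl sj<n) (trans (cong flipTile ne≡) (trans (proj₁ (ne-elbows (proj₂ newB))) (sym se-o')))
    ... | outside o = trans (at-flip-early D a<k l<n) (trans
          (cong flipTile (sym (outD (k ∸ suc a) l (<-≤-trans (flip-< a<k) k≤n) l<n
            (flip-outside si<k a<k (subst (λ r → OutsideBlock r j a l)
              (sym (trans (cong (λ m → k ∸ suc m) (sym upper)) (flip-flip r<k))) o)))))
          (trans (sym (at-flip-early E a<k l<n)) (sym (out a l a<n l<n o))))

  -- The grids of the chain are known to be flips only one step at a time, so the endpoints are
  -- variables with equations. The chain is undone from `E` backwards, and where it ends injectivity
  -- of the flip identifies the grid reached with `D`.
  slides⇒droops : ∀ D E {P Q} → Normal sh D → Normal sh E →
    P ≡ flipGrid E → Q ≡ flipGrid D → P ≤slide Q → D ≤droop E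
  slides⇒droops D E nD nE refl Q≡ ε = subst (_≤droop E) (flip-injective E D nE nD Q≡) ε
  slides⇒droops D E nD nE refl Q≡ (_◅_ {j = Q₁} slide slides) = go (slide⇒undroop E Q₁ nE slide)
    where
    go : (∃ λ F → Normal sh F × DroopStep F E × flipGrid F ≡ Q₁) → D ≤droop E
    go (F , nF , droop , F≡) = slides⇒droops D F nD nF (sym F≡) Q≡ slides ◅◅ (droop ◅ ε)

theorem5p12 : {n : ℕ} (π : Permutation′ n) → Grassmannian π →
    Σ (RedBPD π → RedPD π) λ f →
    ((D E : RedBPD π) → proj₁ (f D) ≡ proj₁ (f E) → proj₁ D ≡ proj₁ E) ×
    ((P : RedPD π) → Σ (RedBPD π) λ D → proj₁ (f D) ≡ proj₁ P) ×
    ((D E : RedBPD π) →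
    (proj₁ D ≤droop proj₁ E) ⇔ (proj₁ (f E) ≤slide proj₁ (f D)))
theorem5p12 {n} π grassmannian with k , sh ← grassmannian⇒shuffle π grassmannian =
  f , (λ D E → flip-injective (proj₁ D) (proj₁ E) (normal D) (normal E)) , onto ,
  λ D E → mk⇔ (droops⇒slides (proj₁ D) (proj₁ E) (normal⇒earlyBlanks (proj₁ D) (normal D)))
              (slides⇒droops (proj₁ D) (proj₁ E) (normal D) (normal E) refl refl)
  where
  open Flip sh
  open FlipNormal sh
  open Steps sh
  open Labelled sh using (Normal; reduced⇒normal; normal⇒exits; normal⇒reduced)

  fromFin : ∀ {exit : ℕ → Maybe ℕ} → (∀ (i : Fin n) → exit (toℕ i) ≡ just (toℕ (π ⟨$⟩ʳ i))) →
    ∀ {i} → i < n → exit i ≡ just (πℕ π i)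
  fromFin {exit} e i<n = subst (λ i → exit i ≡ just (πℕ π i)) (toℕ-fromℕ< i<n)
    (trans (e (fromℕ< i<n)) (cong just (sym (πℕ-Fin π (fromℕ< i<n)))))

  toFin : ∀ {exit : ℕ → Maybe ℕ} → (∀ {i} → i < n → exit i ≡ just (πℕ π i)) →
    ∀ (i : Fin n) → exit (toℕ i) ≡ just (toℕ (π ⟨$⟩ʳ i))
  toFin e i = trans (e (toℕ<n i)) (cong just (πℕ-Fin π i))

  normal : ((D , _) : RedBPD π) → Normal D
  normal (D , tiling , reduced , perm) = reduced⇒normal D tiling reduced (fromFin perm)

  f : RedBPD π → RedPD π
  f D = flipGrid (proj₁ D) , flip-isPD (normal D) , flip-reduced (normal D) , toFin (flip-exits (normal D))

  onto : (P : RedPD π) → Σ (RedBPD π) λ D → proj₁ (f D) ≡ proj₁ P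
  onto (P , isPD , reduced , perm) =
    (unflipGrid P , Labelled.Normal.tiling nD , normal⇒reduced _ nD , toFin (normal⇒exits _ nD)) ,
    flip-unflipGrid P isPD reduced (fromFin perm)
    where nD = unflip-normal P isPD reduced (fromFin perm)
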